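{- For every $\delta > 0$ there exists a constant $L$ such that for all positive integers $s \ge L$ and $k \ge Ls$, \[ r(s,k) \ge \left(\frac{k}{s}\right)^{(1-\delta)s}. \]
   Context: For positive integers $s,k$, the Ramsey number $r(s,k)$ is the minimum integer $n$ such that every graph on $n$ vertices contains a clique of size $s$ or an independent set of size $k$. -}

module Defs where

import Data.Rational.Properties as ℚ
import Algebra.Definitions.RawSemiring
open import Algebra.Properties.Group ℚ.+-0-group using (⁻¹-involutive)
open import Data.Bool using (Bool; true; false; not)
import Data.Bool.Properties as Bool
open import Data.Empty using (⊥-elim)
open import Data.Fin using (Fin; zero; suc)
open import Data.Fin.Properties using (_≟_; all?)
open import Data.Fin.Subset using (Subset; inside; outside; _∈_; ∣_∣; ⊥; ⊤; _∩_; _⊆_)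
open import Data.Fin.Subset.Properties using (anySubset?; _∈?_; ∉⊥; ⊥⊆; ∣⊥∣≡0; ∣⊤∣≡n; x∈p∩q⁻)
open import Data.Integer using (ℤ; +_; -[1+_])
open import Data.Nat as ℕ using (ℕ; zero; suc; s≤s; z≤n)
import Data.Nat.Properties as ℕ
open import Data.Product using (∃; _×_; _,_; proj₁; proj₂)
open import Data.Rational using (ℚ; _<_; _≤_; _+_; _*_; _-_; -_; _/_; 1/_; 0ℚ; 1ℚ; ↥_; ↧ₙ_; NonZero; Positive; +-*-rawSemiring)
open import Data.Sum as Sum using (_⊎_; inj₁; inj₂)
open import Data.Vec using (Vec; []; _∷_; lookup; tabulate; _[_]≔_; here; there)
open import Data.Vec.Properties using (lookup∘tabulate; []=⇒lookup)
open import Function using (_∘_)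
open import Relation.Binary.Definitions using (tri<; tri≈; tri>)
open import Relation.Binary.PropositionalEquality
open import Relation.Nullary using (¬_; Dec; yes; no)
open import Relation.Nullary.Decidable using (map′; _×-dec_; _⊎-dec_; _→-dec_; ¬?; decidable-stable)
open import Relation.Unary using (Decidable)

-- Dedekind cuts (Lower q: q < x; Upper q: x < q).
record ℝ : Set₁ where
  field
    Lower Upper     : ℚ → Set
    lower-inhabited : ∃ Lower
    upper-inhabited : ∃ Upper
    lower-closed    : ∀ {p q} → p < q → Lower q → Lower p
    upper-closed    : ∀ {p q} → p < q → Upper p → Upper q
    lower-open      : ∀ {p} → Lower p → ∃ λ q → p < q × Lower q
    upper-open      : ∀ {q} → Upper q → ∃ λ p → p < q × Upper p
    disjoint        : ∀ {q} → Lower q → ¬ Upper q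
    located         : ∀ {p q} → p < q → Lower p ⊎ Upper q

open ℝ public

infix 4 _<ℝ_ _≤ℝ_

_<ℝ_ : ℝ → ℝ → Set
x <ℝ y = ∃ λ q → Upper x q × Lower y q

_≤ℝ_ : ℝ → ℝ → Set
x ≤ℝ y = ∀ {q} → Lower x q → Lower y q

private
  q-1<q : ∀ q → q - 1ℚ < q
  q-1<q q = subst (q - 1ℚ <_) (ℚ.+-identityʳ q) (ℚ.+-monoʳ-< q (ℚ.negative⁻¹ (- 1ℚ)))

  q<q+1 : ∀ q → q < q + 1ℚ
  q<q+1 q = subst (_< q + 1ℚ) (ℚ.+-identityʳ q) (ℚ.+-monoʳ-< q (ℚ.positive⁻¹ 1ℚ))

fromℚ : ℚ → ℝ
fromℚ x = record
  { Lower           = _< x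
  ; Upper           = x <_
  ; lower-inhabited = x - 1ℚ , q-1<q x
  ; upper-inhabited = x + 1ℚ , q<q+1 x
  ; lower-closed    = ℚ.<-trans
  ; upper-closed    = λ p<q x<p → ℚ.<-trans x<p p<q
  ; lower-open      = λ p<x → let (r , p<r , r<x) = ℚ.<-dense p<x in r , p<r , r<x
  ; upper-open      = λ x<q → let (r , x<r , r<q) = ℚ.<-dense x<q in r , r<q , x<r
  ; disjoint        = ℚ.<-asym
  ; located         = loc
  }
  where
  loc : ∀ {p q} → p < q → p < x ⊎ x < q
  loc {p} p<q with ℚ.<-cmp p x
  ... | tri< p<x _ _  = inj₁ p<x
  ... | tri≈ _ refl _ = inj₂ p<q
  ... | tri> _ _ x<p  = inj₂ (ℚ.<-trans x<p p<q)

ℕ→ℚ : ℕ → ℚ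
ℕ→ℚ n = + n / 1

fromℕ : ℕ → ℝ
fromℕ n = fromℚ (ℕ→ℚ n)

private
  reflect-< : ∀ a {p q} → p < q → a - q < a - p
  reflect-< a p<q = ℚ.+-monoʳ-< a (ℚ.neg-antimono-< p<q)

  reflect² : ∀ a p → a - (a - p) ≡ p
  reflect² a p = begin
    a + - (a + - p)      ≡⟨ cong (λ z → a + z) (ℚ.neg-distrib-+ a (- p)) ⟩
    a + (- a + - - p)    ≡⟨ ℚ.+-assoc a (- a) (- - p) ⟨
    (a + - a) + - - p    ≡⟨ cong₂ _+_ (ℚ.+-inverseʳ a) (⁻¹-involutive p) ⟩
    0ℚ + p               ≡⟨ ℚ.+-identityˡ p ⟩
    p                    ∎
    where open ≡-Reasoning

infixl 6 _⊖_

-- The real number a − x: q < a − x iff x < a − q.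
_⊖_ : ℚ → ℝ → ℝ
a ⊖ x = record
  { Lower           = λ q → Upper x (a - q)
  ; Upper           = λ q → Lower x (a - q)
  ; lower-inhabited = let (q , Uq) = upper-inhabited x in a - q , subst (Upper x) (sym (reflect² a q)) Uq
  ; upper-inhabited = let (q , Lq) = lower-inhabited x in a - q , subst (Lower x) (sym (reflect² a q)) Lq
  ; lower-closed    = λ p<q → upper-closed x (reflect-< a p<q)
  ; upper-closed    = λ p<q → lower-closed x (reflect-< a p<q)
  ; lower-open      = λ {p} U → let (r , r<a-p , Ur) = upper-open x U in
                      a - r , subst (_< a - r) (reflect² a p) (reflect-< a r<a-p)
                            , subst (Upper x) (sym (reflect² a r)) Ur
  ; upper-open      = λ {q} L → let (r , a-q<r , Lr) = lower-open x L in
                      a - r , subst (a - r <_) (reflect² a q) (reflect-< a a-q<r)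
                            , subst (Lower x) (sym (reflect² a r)) Lr
  ; disjoint        = λ U L → disjoint x L U
  ; located         = λ p<q → Sum.swap (located x (reflect-< a p<q))
  }

infixl 7 _·_

-- The real number x·n for an integer n > 0: q < x·n iff q/n < x.
_·_ : ℝ → (n : ℕ) → .{{ℕ.NonZero n}} → ℝ
_·_ x n = record
  { Lower           = λ q → Lower x (q * d)
  ; Upper           = λ q → Upper x (q * d)
  ; lower-inhabited = let (q , Lq) = lower-inhabited x in q * c , subst (Lower x) (sym (cd q)) Lq
  ; upper-inhabited = let (q , Uq) = upper-inhabited x in q * c , subst (Upper x) (sym (cd q)) Uq
  ; lower-closed    = λ p<q → lower-closed x (d-mono p<q)
  ; upper-closed    = λ p<q → upper-closed x (d-mono p<q)
  ; lower-open      = λ {p} L → let (r , p<r , Lr) = lower-open x L in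
                      r * c , subst (_< r * c) (dc p) (c-mono p<r)
                            , subst (Lower x) (sym (cd r)) Lr
  ; upper-open      = λ {q} U → let (r , r<q , Ur) = upper-open x U in
                      r * c , subst (r * c <_) (dc q) (c-mono r<q)
                            , subst (Upper x) (sym (cd r)) Ur
  ; disjoint        = disjoint x
  ; located         = λ p<q → located x (d-mono p<q)
  }
  where
  d c : ℚ
  d = + 1 / n
  instance
    d-pos : Positive d
    d-pos = ℚ.normalize-pos 1 n
    d≢0 : NonZero d
    d≢0 = ℚ.pos⇒nonZero d
  c = 1/ d
  instance
    c-pos : Positive c
    c-pos = ℚ.1/pos⇒pos d
  d-mono : ∀ {p q} → p < q → p * d < q * d
  d-mono = ℚ.*-monoˡ-<-pos d
  c-mono : ∀ {p q} → p < q → p * c < q * c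
  c-mono = ℚ.*-monoˡ-<-pos c
  cd : ∀ q → q * c * d ≡ q
  cd q = trans (ℚ.*-assoc q c d) (trans (cong (q *_) (ℚ.*-inverseˡ d)) (ℚ.*-identityʳ q))
  dc : ∀ q → q * d * c ≡ q
  dc q = trans (ℚ.*-assoc q d c) (trans (cong (q *_) (ℚ.*-inverseʳ d)) (ℚ.*-identityʳ q))

open Algebra.Definitions.RawSemiring +-*-rawSemiring public using (_^_)

infix 4 _^ℚ_≤_ _^ℝ_≤_

_^ℤ_ : (b : ℚ) → .{{Positive b}} → ℤ → ℚ
b ^ℤ (+ n)      = b ^ n
b ^ℤ (-[1+ n ]) = (1/ b) ^ suc n
  where instance _ = ℚ.pos⇒nonZero b

-- b^t ≤ N for rational t = m/n: as b^t is the positive n-th root of b^m and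
-- N ≥ 0, this says b^m ≤ N^n.
_^ℚ_≤_ : (b : ℚ) → .{{Positive b}} → ℚ → ℕ → Set
b ^ℚ t ≤ N = b ^ℤ (↥ t) ≤ ℕ→ℚ N ^ (↧ₙ t)

-- b^α ≤ N for real α.  If b ≥ 1 then b^α is by definition the supremum of b^t
-- over rational t < α; if b ≤ 1 it is the supremum over rational t > α.
_^ℝ_≤_ : (b : ℚ) → .{{Positive b}} → ℝ → ℕ → Set
b ^ℝ α ≤ N = (1ℚ ≤ b → ∀ t → Lower α t → b ^ℚ t ≤ N)
           × (b ≤ 1ℚ → ∀ t → Upper α t → b ^ℚ t ≤ N)

/-positive : ∀ k s → .{{_ : ℕ.NonZero s}} → .{{ℕ.NonZero k}} → Positive (+ k / s)
/-positive k s = ℚ.normalize-pos k s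

record Graph (n : ℕ) : Set where
  field
    adj        : Fin n → Fin n → Bool
    symmetric  : ∀ i j → adj i j ≡ adj j i
    loopless   : ∀ i → adj i i ≡ false

open Graph public

Homogeneous : ∀ {n} → (Fin n → Fin n → Bool) → Bool → Subset n → Set
Homogeneous a b S = ∀ i j → i ∈ S → j ∈ S → ¬ i ≡ j → a i j ≡ b

IsClique IsIndependent : ∀ {n} → Graph n → Subset n → Set
IsClique      G = Homogeneous (adj G) true
IsIndependent G = Homogeneous (adj G) false

RamseyProperty : ℕ → ℕ → ℕ → Set
RamseyProperty s k n = (G : Graph n) →
    (∃ λ S → IsClique G S × ∣ S ∣ ≡ s)
  ⊎ (∃ λ S → IsIndependent G S × ∣ S ∣ ≡ k)

IsLeast : (ℕ → Set) → ℕ → Set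
IsLeast P n = P n × (∀ m → P m → n ℕ.≤ m)

private
  allSubset? : ∀ {n} {P : Subset n → Set} → Decidable P → Dec (∀ S → P S)
  allSubset? P? with anySubset? (¬? ∘ P?)
  ... | yes (S , ¬PS) = no λ all → ¬PS (all S)
  ... | no ¬∃         = yes λ S → decidable-stable (P? S) λ ¬PS → ¬∃ (S , ¬PS)

  allMatrix? : ∀ {n} m {P : Vec (Subset n) m → Set} → Decidable P → Dec (∀ M → P M)
  allMatrix? zero    P? = map′ (λ { p [] → p }) (λ f → f []) (P? [])
  allMatrix? (suc m) P? = map′ (λ { f (S ∷ M) → f S M }) (λ f S M → f (S ∷ M))
    (allSubset? λ S → allMatrix? m λ M → P? (S ∷ M))

  homogeneous? : ∀ {n} (a : Fin n → Fin n → Bool) b → Decidable (Homogeneous a b)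
  homogeneous? a b S = all? λ i → all? λ j →
    (i ∈? S) →-dec ((j ∈? S) →-dec (¬? (i ≟ j) →-dec (a i j Bool.≟ b)))

  entry : ∀ {n} → Vec (Subset n) n → Fin n → Fin n → Bool
  entry M i j = lookup (lookup M i) j

  MatrixRamsey : ℕ → ℕ → ∀ {n} → Vec (Subset n) n → Set
  MatrixRamsey s k M =
    (∀ i j → entry M i j ≡ entry M j i) → (∀ i → entry M i i ≡ false) →
      (∃ λ S → Homogeneous (entry M) true  S × ∣ S ∣ ≡ s)
    ⊎ (∃ λ S → Homogeneous (entry M) false S × ∣ S ∣ ≡ k)

  matrixRamsey? : ∀ s k {n} → Decidable (MatrixRamsey s k {n})
  matrixRamsey? s k M =
    (all? λ i → all? λ j → entry M i j Bool.≟ entry M j i) →-dec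
    ((all? λ i → entry M i i Bool.≟ false) →-dec
    (has true s ⊎-dec has false k))
    where
    has : ∀ b m → Dec (∃ λ S → Homogeneous (entry M) b S × ∣ S ∣ ≡ m)
    has b m = anySubset? λ S → homogeneous? (entry M) b S ×-dec (∣ S ∣ ℕ.≟ m)

  ramsey? : ∀ s k → Decidable (RamseyProperty s k)
  ramsey? s k n = map′ to from (allMatrix? n (matrixRamsey? s k))
    where
    to : (∀ M → MatrixRamsey s k {n} M) → RamseyProperty s k n
    to f G = Sum.map conv conv (f M
      (λ i j → trans (eq i j) (trans (symmetric G i j) (sym (eq j i))))
      (λ i → trans (eq i i) (loopless G i)))
      where
      M : Vec (Subset n) n
      M = tabulate λ i → tabulate (adj G i)
      eq : ∀ i j → entry M i j ≡ adj G i j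
      eq i j = trans (cong (λ v → lookup v j) (lookup∘tabulate (λ i → tabulate (adj G i)) i))
                     (lookup∘tabulate (adj G i) j)
      conv : ∀ {b m} → (∃ λ S → Homogeneous (entry M) b S × ∣ S ∣ ≡ m) →
                       (∃ λ S → Homogeneous (adj G) b S × ∣ S ∣ ≡ m)
      conv (S , h , e) = S , (λ i j i∈S j∈S i≢j → trans (sym (eq i j)) (h i j i∈S j∈S i≢j)) , e
    from : RamseyProperty s k n → ∀ M → MatrixRamsey s k {n} M
    from f M sm lp = f record { adj = entry M ; symmetric = sm ; loopless = lp }

  least : ∀ {P : ℕ → Set} → Decidable P → ∀ N → P N → ∃ (IsLeast P)
  least P? zero p = 0 , p , λ _ _ → z≤n
  least {P} P? (suc N) p with P? 0
  ... | yes p₀ = 0 , p₀ , λ _ _ → z≤n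
  ... | no ¬p₀ with least {P ∘ suc} (P? ∘ suc) N p
  ...   | n , pn , min = suc n , pn , λ { zero q → ⊥-elim (¬p₀ q) ; (suc m) q → s≤s (min m q) }

  bound : ℕ → ℕ → ℕ
  bound zero    k       = 0
  bound (suc s) zero    = 0
  bound (suc s) (suc k) = suc (bound s (suc k) ℕ.+ bound (suc s) k)

  choose : ∀ {n m} (V : Subset n) → suc m ℕ.≤ ∣ V ∣ → ∃ λ v → v ∈ V
  choose (inside  ∷ V) _ = zero , here
  choose (outside ∷ V) h = let (v , v∈V) = choose V h in suc v , there v∈V

  ∣insert∣ : ∀ {n} (p : Subset n) v → ¬ v ∈ p → ∣ p [ v ]≔ inside ∣ ≡ suc ∣ p ∣
  ∣insert∣ (inside  ∷ p) zero    v∉ = ⊥-elim (v∉ here)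
  ∣insert∣ (outside ∷ p) zero    v∉ = refl
  ∣insert∣ (inside  ∷ p) (suc v) v∉ = cong suc (∣insert∣ p v (v∉ ∘ there))
  ∣insert∣ (outside ∷ p) (suc v) v∉ = ∣insert∣ p v (v∉ ∘ there)

  ∣remove∣ : ∀ {n} (p : Subset n) v → v ∈ p → suc ∣ p [ v ]≔ outside ∣ ≡ ∣ p ∣
  ∣remove∣ (inside  ∷ p) zero    here        = refl
  ∣remove∣ (inside  ∷ p) (suc v) (there v∈p) = cong suc (∣remove∣ p v v∈p)
  ∣remove∣ (outside ∷ p) (suc v) (there v∈p) = ∣remove∣ p v v∈p

  ∈insert : ∀ {n} (p : Subset n) v {x} → x ∈ p [ v ]≔ inside → x ≡ v ⊎ x ∈ p
  ∈insert (_ ∷ p) zero    {zero}  _         = inj₁ refl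
  ∈insert (_ ∷ p) zero    {suc x} (there h) = inj₂ (there h)
  ∈insert (_ ∷ p) (suc v) {zero}  here      = inj₂ here
  ∈insert (_ ∷ p) (suc v) {suc x} (there h) = Sum.map (cong suc) there (∈insert p v h)

  ∈remove : ∀ {n} (p : Subset n) v {x} → x ∈ p [ v ]≔ outside → ¬ x ≡ v × x ∈ p
  ∈remove (_ ∷ p) zero    {suc x} (there h) = (λ ()) , there h
  ∈remove (_ ∷ p) (suc v) {zero}  here      = (λ ()) , here
  ∈remove (_ ∷ p) (suc v) {suc x} (there h) =
    let (x≢v , x∈p) = ∈remove p v h in (λ { refl → x≢v refl }) , there x∈p

  ∣split∣ : ∀ {n} (p : Subset n) f → ∣ p ∩ tabulate f ∣ ℕ.+ ∣ p ∩ tabulate (not ∘ f) ∣ ≡ ∣ p ∣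
  ∣split∣ []            f = refl
  ∣split∣ (outside ∷ p) f = ∣split∣ p (f ∘ suc)
  ∣split∣ (inside  ∷ p) f with f zero
  ... | true  = cong suc (∣split∣ p (f ∘ suc))
  ... | false = trans (ℕ.+-suc _ _) (cong suc (∣split∣ p (f ∘ suc)))

  pigeonhole : ∀ {a b c d} → a ℕ.+ b ℕ.≤ c ℕ.+ d → a ℕ.≤ c ⊎ b ℕ.≤ d
  pigeonhole {a} {b} {c} {d} h with a ℕ.≤? c
  ... | yes a≤c = inj₁ a≤c
  ... | no a≰c with b ℕ.≤? d
  ...   | yes b≤d = inj₂ b≤d
  ...   | no b≰d = ⊥-elim (ℕ.<⇒≱ (ℕ.+-mono-< (ℕ.≰⇒> a≰c) (ℕ.≰⇒> b≰d)) h)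

  module _ {n} (G : Graph n) where

    Found : Subset n → Bool → ℕ → Set
    Found V b m = ∃ λ S → S ⊆ V × Homogeneous (adj G) b S × ∣ S ∣ ≡ m

    found-0 : ∀ V b → Found V b 0
    found-0 V b = ⊥ , ⊥⊆ , (λ i j i∈⊥ → ⊥-elim (∉⊥ i∈⊥)) , ∣⊥∣≡0 n

    widen : ∀ {V W b m} → V ⊆ W → Found V b m → Found W b m
    widen V⊆W (S , S⊆V , r) = S , V⊆W ∘ S⊆V , r

    extend : ∀ {V W b m} v → v ∈ W → V ⊆ W → ¬ v ∈ V → (∀ {x} → x ∈ V → adj G v x ≡ b) →
             Found V b m → Found W b (suc m)
    extend {V} {W} {b} v v∈W V⊆W v∉V nb (S , S⊆V , h , e) =
      S [ v ]≔ inside , sub , hom , trans (∣insert∣ S v (v∉V ∘ S⊆V)) (cong suc e)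
      where
      sub : S [ v ]≔ inside ⊆ W
      sub x∈ with ∈insert S v x∈
      ... | inj₁ refl = v∈W
      ... | inj₂ x∈S  = V⊆W (S⊆V x∈S)
      hom : Homogeneous (adj G) b (S [ v ]≔ inside)
      hom i j i∈ j∈ i≢j with ∈insert S v i∈ | ∈insert S v j∈
      ... | inj₁ refl | inj₁ refl = ⊥-elim (i≢j refl)
      ... | inj₁ refl | inj₂ j∈S  = nb (S⊆V j∈S)
      ... | inj₂ i∈S  | inj₁ refl = trans (symmetric G i j) (nb (S⊆V i∈S))
      ... | inj₂ i∈S  | inj₂ j∈S  = h i j i∈S j∈S i≢j

    ramsey-within : ∀ s k V → bound s k ℕ.≤ ∣ V ∣ → Found V true s ⊎ Found V false k
    ramsey-within zero    k       V _ = inj₁ (found-0 V true)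
    ramsey-within (suc s) zero    V _ = inj₂ (found-0 V false)
    ramsey-within (suc s) (suc k) V h with choose V h
    ... | v , v∈V = step (pigeonhole (subst (_ ℕ.≤_) (sym (∣split∣ V′ (adj G v))) h′))
      where
      V′ A B : Subset n
      V′ = V [ v ]≔ outside
      A  = V′ ∩ tabulate (adj G v)
      B  = V′ ∩ tabulate (not ∘ adj G v)
      h′ : bound s (suc k) ℕ.+ bound (suc s) k ℕ.≤ ∣ V′ ∣
      h′ = ℕ.s≤s⁻¹ (subst (_ ℕ.≤_) (sym (∣remove∣ V v v∈V)) h)
      in⇒ : ∀ f {x} → x ∈ tabulate f → f x ≡ true
      in⇒ f {x} x∈ = trans (sym (lookup∘tabulate f x)) ([]=⇒lookup x∈)
      A⊆V : A ⊆ V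
      A⊆V x∈ = proj₂ (∈remove V v (proj₁ (x∈p∩q⁻ V′ _ x∈)))
      B⊆V : B ⊆ V
      B⊆V x∈ = proj₂ (∈remove V v (proj₁ (x∈p∩q⁻ V′ _ x∈)))
      v∉A : ¬ v ∈ A
      v∉A v∈ = proj₁ (∈remove V v (proj₁ (x∈p∩q⁻ V′ _ v∈))) refl
      v∉B : ¬ v ∈ B
      v∉B v∈ = proj₁ (∈remove V v (proj₁ (x∈p∩q⁻ V′ _ v∈))) refl
      A-nb : ∀ {x} → x ∈ A → adj G v x ≡ true
      A-nb x∈ = in⇒ (adj G v) (proj₂ (x∈p∩q⁻ V′ _ x∈))
      B-nb : ∀ {x} → x ∈ B → adj G v x ≡ false
      B-nb x∈ = Bool.not-injective (in⇒ (not ∘ adj G v) (proj₂ (x∈p∩q⁻ V′ _ x∈)))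
      step : bound s (suc k) ℕ.≤ ∣ A ∣ ⊎ bound (suc s) k ℕ.≤ ∣ B ∣ →
             Found V true (suc s) ⊎ Found V false (suc k)
      step (inj₁ hA) = Sum.map (extend v v∈V A⊆V v∉A A-nb) (widen A⊆V) (ramsey-within s (suc k) A hA)
      step (inj₂ hB) = Sum.map (widen B⊆V) (extend v v∈V B⊆V v∉B B-nb) (ramsey-within (suc s) k B hB)

  ramsey-bound : ∀ s k → RamseyProperty s k (bound s k)
  ramsey-bound s k G = Sum.map drop drop
    (ramsey-within G s k ⊤ (ℕ.≤-reflexive (sym (∣⊤∣≡n (bound s k)))))
    where
    drop : ∀ {b m} → Found G ⊤ b m → ∃ λ S → Homogeneous (adj G) b S × ∣ S ∣ ≡ m
    drop (S , _ , h , e) = S , h , e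

  leastRamsey : ∀ s k → ∃ (IsLeast (RamseyProperty s k))
  leastRamsey s k = least (ramsey? s k) (bound s k) (ramsey-bound s k)

abstract
  r : ℕ → ℕ → ℕ
  r s k = proj₁ (leastRamsey s k)

  r-isLeast : ∀ s k → IsLeast (RamseyProperty s k) (r s k)
  r-isLeast s k = proj₂ (leastRamsey s k)

{-# OPTIONS --safe #-}
module Submission where

-- Let p be a prime slightly smaller than k/s, and let V be the vector space of dimension
-- s − 1 over the field with p elements. Draw n random pairs (aᵢ, yᵢ) ∈ V × V with
-- ⟨aᵢ, yᵢ⟩ ≠ 0, and join i < j when ⟨aᵢ, yⱼ⟩ = 0. Along a clique the matrix ⟨aᵢ, yⱼ⟩ is
-- triangular with nonzero diagonal, so there is no clique of size s. An independent sequence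
-- confines its next y to the set B of vectors orthogonal to no earlier a. By a second
-- moment estimate, all but p^O(1) |V| / |B| vectors a are orthogonal to at least a fraction
-- 1/(2p) of B. An exceptional a together with y ∈ B can thus be chosen in only p^O(1) |V|
-- ways, while any other a shrinks B by a factor 1 − 1/(2p), which can happen only about
-- 2p log |V| times. Hence a k-tuple is independent with probability about |V|^(−k), and n
-- can be taken to be |V|^(1 − o(1)) = (k/s)^((1 − o(1)) s).

open import Defs hiding (_^_)
open import Data.Bool using (Bool; true; false; not; _∧_)
open import Data.Fin as Fin using (Fin; zero; suc; toℕ; punchIn)
import Data.Fin.Properties as Fin
open import Data.Fin.Subset using (Subset; inside; outside; ∣_∣) renaming (_∈_ to _∈ₛ_)
open import Data.Integer as ℤ using (ℤ; +_; -[1+_])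
import Data.Integer.Divisibility.Signed as ℤ
import Data.Integer.Properties as ℤ
import Data.Integer.Tactic.RingSolver as ℤ-Solver
open import Algebra.Properties.Semiring.Sum ℤ.+-*-semiring using (sum; sum-remove; sum-cong-≗; *-distribˡ-sum) renaming (∑-distrib-+ to sum-distrib-+)
open import Data.List using (List; []; _∷_; _++_; map; length; cartesianProductWith; allFin; tabulate)
open import Data.List.Membership.Propositional using (_∈_)
open import Data.List.Membership.Propositional.Properties using (∈-allFin)
open import Data.List.Properties using (length-map; length-tabulate)
open import Data.List.Relation.Unary.All as All using (All; []; _∷_)
import Data.List.Relation.Unary.All.Properties as All
open import Data.List.Relation.Unary.AllPairs as AllPairs using (AllPairs; []; _∷_)
import Data.List.Relation.Unary.AllPairs.Properties as AllPairs
open import Data.List.Relation.Unary.Any using (here; there)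
open import Data.List.Relation.Unary.Unique.Propositional using (Unique)
import Data.List.Relation.Unary.Unique.Propositional.Properties as Unique
open import Data.Nat as ℕ hiding (_/_; _%_)
open import Data.Nat.Coprimality using (Coprime)
open import Data.Nat.DivMod using (_mod_; m%n<n; m≡m%n+[m/n]*n; m/n*n≤m)
open import Data.Nat.Divisibility
open import Data.Nat.Induction using (<-rec)
open import Data.Nat.ListAction using (product)
open import Data.Nat.Primality
open import Data.Nat.Primality.Factorisation using (factorise)
open import Data.Nat.Properties
open import Data.Nat.Tactic.RingSolver using (solve-∀)
open import Data.Product using (∃; ∃₂; _×_; _,_; proj₁; proj₂)
open import Data.Rational as ℚ using (mkℚ; _/_; 0ℚ; 1ℚ; 1/_; Positive; NonNegative; toℚᵘ)
import Data.Rational.Properties as ℚ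
open import Data.Rational.Unnormalised as ℚᵘ using (mkℚᵘ; *≤*; *<*; *≡*)
import Data.Rational.Unnormalised.Properties as ℚᵘ
open import Data.Sum using (_⊎_; inj₁; inj₂; [_,_]′)
open import Data.Vec as Vec using (Vec; []; _∷_; lookup; here; there; replicate)
import Data.Vec.Properties as Vec
open import Data.Vec.Relation.Unary.All as VAll using ([]; _∷_)
import Data.Vec.Relation.Unary.All.Properties as VAll
open import Function using (_∘_)
open import Relation.Binary.PropositionalEquality
open import Relation.Nullary using (¬_; Dec; yes; no; does; contradiction)
open import Relation.Nullary.Decidable using (¬?; decidable-stable)

-- Primes in short intervals

-- The obstacle is that a non-exceptional step may leave as many as |V|² choices, and which steps
-- are exceptional depends on all earlier ones. The potential |B|^θ spares any enumeration of
-- patterns: for θ about 2p log₂ |V| a non-exceptional step lowers it by a factor |V|, so every step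
-- costs p^O(1) |V| when weighted by the potential, and only the initial value |V|^θ remains to be
-- paid. That is harmless when θ is a small fraction of k; as log₂ |V| is (s - 1) log₂ p, this asks
-- p log p to be small against k/s. So p must lie a logarithmic factor below k/s in any case, and
-- losing one more logarithm in the search for a prime does no harm: an elementary bound of
-- Chebyshev type replaces Bertrand's postulate. The logarithms are absorbed because k/s is large,
-- the factors p^O(1) because s is large. The counting estimates are cleared of denominators and
-- roots, and real exponents enter only at the very end.

^-distribʳ-* : ∀ k m n → (m * n) ^ k ≡ m ^ k * n ^ k
^-distribʳ-* zero    m n = refl
^-distribʳ-* (suc k) m n = trans (cong (m * n *_) (^-distribʳ-* k m n)) (interchange m n (m ^ k) (n ^ k))
  where
  interchange : ∀ a b c d → a * b * (c * d) ≡ a * c * (b * d)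
  interchange = solve-∀

m≤m^n : ∀ m {n} → 1 ≤ n → m ≤ m ^ n
m≤m^n zero      1≤n = z≤n
m≤m^n m@(suc _) 1≤n = ≤-trans (≤-reflexive (sym (*-identityʳ m))) (^-monoʳ-≤ m 1≤n)

CommonMultiple : ℕ → ℕ → Set
CommonMultiple m Q = ∀ j → 1 ≤ j → j ≤ m → j ∣ Q

-- Q · i! · j! / (i + j + 1)! is Q ∫₀¹ xⁱ (1 − x)ʲ dx, and the recursion in j is
-- the linearity of the integral.
beta-integral : ∀ {m Q} → CommonMultiple m Q → ∀ i j → i + j < m →
  (suc (i + j)) ! ∣ i ! * j ! * Q
beta-integral {m} {Q} cm i zero i<m =
  subst₂ (λ a b → suc a * (a !) ∣ b) (sym (+-identityʳ i)) (eq (i !) Q)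
    (*-monoˡ-∣ (i !) (cm (suc i) (s≤s z≤n) (subst (_< m) (+-identityʳ i) i<m)))
  where
  eq : ∀ f q → q * f ≡ f * 1 * q
  eq = solve-∀
beta-integral {m} {Q} cm i (suc j) lt =
  ∣m+n∣m⇒∣n (subst (_∣ suc i * (i !) * j ! * Q + i ! * (suc j) ! * Q) N+1!
              (subst ((2 + (i + j)) * (suc (i + j)) ! ∣_) (split i j (i !) (j !) Q)
                (*-monoʳ-∣ (2 + (i + j)) (beta-integral cm i j (<-trans (n<1+n _) lt′)))))
            (subst (_∣ (suc i) ! * j ! * Q) (cong (λ z → suc z !) (sym (+-suc i j)))
              (beta-integral cm (suc i) j lt′))
  where
  lt′ : suc (i + j) < m
  lt′ = subst (_< m) (+-suc i j) lt
  N+1! : (2 + (i + j)) * (suc (i + j)) ! ≡ (suc (i + suc j)) !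
  N+1! = cong (λ z → suc z !) (sym (+-suc i j))
  split : ∀ i j f g q → (2 + (i + j)) * (f * g * q) ≡ (1 + i) * f * g * q + f * ((1 + j) * g) * q
  split = solve-∀

-- From n to n + 1 the left side gains (2n + 2)², the right side (2n + 2)(2n + 3).
4^n*n!²≤[2n+1]! : ∀ n → 4 ^ n * (n ! * n !) ≤ (suc (n + n)) !
4^n*n!²≤[2n+1]! zero    = ≤-refl
4^n*n!²≤[2n+1]! (suc n) = begin
  4 * 4 ^ n * (suc n * n ! * (suc n * n !))               ≡⟨ eq n (4 ^ n) (n !) ⟩
  (2 + 2 * n) * ((2 + 2 * n) * (4 ^ n * (n ! * n !)))
    ≤⟨ *-mono-≤ {2 + 2 * n} {3 + 2 * n} (n≤1+n _) (*-monoʳ-≤ (2 + 2 * n) (4^n*n!²≤[2n+1]! n)) ⟩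
  (3 + 2 * n) * ((2 + 2 * n) * suc (n + n) !)             ≡⟨ cong₂ (λ a b → a * (b * suc (n + n) !)) (eq₃ n) (eq₂ n) ⟩
  (suc (suc n + suc n)) * (suc (suc (n + n)) * suc (n + n) !) ≡⟨ cong (λ z → suc (suc n + suc n) * z !) (sym (+-suc (suc n) n)) ⟩
  suc (suc n + suc n) ! ∎
  where
  open ≤-Reasoning
  eq : ∀ n q f → 4 * q * ((1 + n) * f * ((1 + n) * f)) ≡ (2 + 2 * n) * ((2 + 2 * n) * (q * (f * f)))
  eq = solve-∀
  eq₂ : ∀ n → 2 + 2 * n ≡ suc (suc (n + n))
  eq₂ = solve-∀
  eq₃ : ∀ n → 3 + 2 * n ≡ suc (suc n + suc n)
  eq₃ = solve-∀

-- Nair's argument: Q ∫₀¹ xⁿ (1 - x)ⁿ dx is a positive integer, while the integrand is at most 4⁻ⁿ.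
-- Here the integrality is the divisibility from `beta-integral` at i = j = n.
4^n≤commonMultiple : ∀ n {Q} .{{_ : NonZero Q}} → CommonMultiple (suc (n + n)) Q → 4 ^ n ≤ Q
4^n≤commonMultiple n {Q} cm = *-cancelʳ-≤ (4 ^ n) Q (n ! * n !) (begin
  4 ^ n * (n ! * n !)   ≤⟨ 4^n*n!²≤[2n+1]! n ⟩
  (suc (n + n)) !       ≤⟨ ∣⇒≤ (beta-integral cm n n ≤-refl) ⟩
  n ! * n ! * Q         ≡⟨ *-comm (n ! * n !) Q ⟩
  Q * (n ! * n !)       ∎)
  where
  open ≤-Reasoning
  instance
    n!≢0 : NonZero (n !)
    n!≢0 = >-nonZero (1≤n! n)
    n!²≢0 : NonZero (n ! * n !)
    n!²≢0 = m*n≢0 (n !) (n !)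
    _ : NonZero (n ! * n ! * Q)
    _ = m*n≢0 (n ! * n !) Q

largest-power≤ : ∀ q → 2 ≤ q → ∀ m → 1 ≤ m → ∃ λ v → q ^ v ≤ m × m < q ^ suc v
largest-power≤ q 2≤q (suc zero) _ = 0 , ≤-refl , subst (1 <_) (sym (*-identityʳ q)) 2≤q
largest-power≤ q 2≤q (suc (suc m)) _ with largest-power≤ q 2≤q (suc m) (s≤s z≤n)
... | v , lo , hi with q ^ suc v ≤? suc (suc m)
...   | yes le = suc v , le , ≤-<-trans hi (^-monoʳ-< q 2≤q (n<1+n (suc v)))
...   | no ¬le = v , m≤n⇒m≤1+n lo , ≰⇒> ¬le

remove-factor : ∀ q → 2 ≤ q → ∀ j → 1 ≤ j → ∃₂ λ v j′ → j ≡ q ^ v * j′ × ¬ q ∣ j′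
remove-factor q 2≤q = <-rec _ step
  where
  go : ∀ j .{{_ : NonZero j}} → (∀ {i} → i < j → 1 ≤ i → ∃₂ λ v j′ → i ≡ q ^ v * j′ × ¬ q ∣ j′) →
       ∃₂ λ v j′ → j ≡ q ^ v * j′ × ¬ q ∣ j′
  go j rec with q ∣? j
  ... | no q∤j = 0 , j , sym (*-identityˡ j) , q∤j
  ... | yes q∣j@(divides zero eq) = contradiction eq (≢-nonZero⁻¹ j)
  ... | yes q∣j@(divides (suc i) eq) with rec {suc i} (quotient-< q∣j {{n>1⇒nonTrivial 2≤q}}) (s≤s z≤n)
  ...   | v , j′ , eq′ , q∤j′ = suc v , j′ , trans eq (trans (cong (_* q) eq′) (assoc q (q ^ v) j′)) , q∤j′
    where
    assoc : ∀ q r j → r * j * q ≡ q * r * j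
    assoc = solve-∀
  step : ∀ j → (∀ {i} → i < j → 1 ≤ i → ∃₂ λ v j′ → i ≡ q ^ v * j′ × ¬ q ∣ j′) →
         1 ≤ j → ∃₂ λ v j′ → j ≡ q ^ v * j′ × ¬ q ∣ j′
  step j rec 1≤j = go j {{>-nonZero 1≤j}} rec

Smooth : ℕ → ℕ → Set
Smooth x j = ∀ q → Prime q → q ∣ j → q ≤ x

0-smooth⇒≡1 : ∀ j .{{_ : NonZero j}} → Smooth 0 j → j ≡ 1
0-smooth⇒≡1 j sm with factorise j
... | record { factors = [] ; isFactorisation = eq } = eq
... | record { factors = q ∷ qs ; isFactorisation = eq ; factorsPrime = pq ∷ _ } =
  contradiction (subst Prime (n≤0⇒n≡0 (sm q pq (subst (q ∣_) (sym eq) (m∣m*n (product qs))))) pq) ¬prime[0]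

prime⇒2≤ : ∀ {p} → Prime p → 2 ≤ p
prime⇒2≤ {p} pr = nonTrivial⇒n>1 p {{prime⇒nonTrivial pr}}

-- `Q` is the product over the primes q ≤ x of the largest power of q up to m. Each such power is at
-- most m, and spending a factor m on every integer up to x, prime or not, is cheap enough.
smooth-multiple : ∀ m → 1 ≤ m → ∀ x → ∃ λ Q → 1 ≤ Q × Q ≤ m ^ x ×
  (∀ j → 1 ≤ j → j ≤ m → Smooth x j → j ∣ Q)
smooth-multiple m 1≤m zero = 1 , ≤-refl , ≤-refl ,
  λ j 1≤j _ sm → ∣-reflexive (0-smooth⇒≡1 j {{>-nonZero 1≤j}} sm)
smooth-multiple m 1≤m (suc x) with smooth-multiple m 1≤m x | prime? (suc x)
... | Q , 1≤Q , Q≤ , cm | no ¬pr =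
  Q , 1≤Q , ≤-trans Q≤ (m≤n*m (m ^ x) m {{>-nonZero 1≤m}}) ,
  λ j 1≤j j≤m sm → cm j 1≤j j≤m λ q pq q∣j → s≤s⁻¹ (≤∧≢⇒< (sm q pq q∣j) λ { refl → ¬pr pq })
... | Q , 1≤Q , Q≤ , cm | yes pr with largest-power≤ (suc x) (prime⇒2≤ pr) m 1≤m
...   | v , top≤ , top> =
  suc x ^ v * Q , *-mono-≤ (m^n>0 (suc x) v) 1≤Q , *-mono-≤ top≤ Q≤ , cm′
  where
  cm′ : ∀ j → 1 ≤ j → j ≤ m → Smooth (suc x) j → j ∣ suc x ^ v * Q
  cm′ j 1≤j j≤m sm with remove-factor (suc x) (prime⇒2≤ pr) j 1≤j
  ... | w , zero , refl , q∤j′ = contradiction (suc x ∣0) q∤j′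
  ... | w , j′@(suc _) , refl , q∤j′ = *-pres-∣ pow-∣ (cm j′ (s≤s z≤n) (≤-trans (m≤n*m j′ (suc x ^ w)) j≤m)
        λ q pq q∣j′ → s≤s⁻¹ (≤∧≢⇒< (sm q pq (∣n⇒∣m*n (suc x ^ w) q∣j′)) λ { refl → q∤j′ q∣j′ }))
    where
    instance
      _ : NonZero (suc x ^ w)
      _ = >-nonZero (m^n>0 (suc x) w)
    w≤v : w ≤ v
    w≤v = s≤s⁻¹ (≰⇒> λ v<w → <⇒≱ top> (≤-trans (^-monoʳ-≤ (suc x) v<w) (≤-trans (m≤m*n (suc x ^ w) j′) j≤m)))
    pow-∣ : suc x ^ w ∣ suc x ^ v
    pow-∣ = subst (suc x ^ w ∣_) (trans (sym (^-distribˡ-+-* (suc x) w (v ∸ w))) (cong (suc x ^_) (m+[n∸m]≡n w≤v)))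
              (m∣m*n (suc x ^ (v ∸ w)))

largest-prime≤ : ∀ m → 2 ≤ m → ∃ λ p → Prime p × p ≤ m × (∀ q → Prime q → q ≤ m → q ≤ p)
largest-prime≤ (suc zero) (s≤s ())
largest-prime≤ (suc (suc m)) _ = from-2 m
  where
  from-2 : ∀ m → ∃ λ p → Prime p × p ≤ 2 + m × (∀ q → Prime q → q ≤ 2 + m → q ≤ p)
  from-2 zero    = 2 , prime[2] , ≤-refl , λ _ _ q≤2 → q≤2
  from-2 (suc m) with from-2 m | prime? (3 + m)
  ... | _ | yes pr = 3 + m , pr , ≤-refl , λ _ _ q≤ → q≤
  ... | p , pr , p≤m , max | no ¬pr = p , pr , m≤n⇒m≤1+n p≤m ,
    λ q pq q≤ → max q pq (s≤s⁻¹ (≤∧≢⇒< q≤ λ { refl → ¬pr pq }))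

-- With m = 2n + 1 and p the largest prime up to m, every positive integer up to m is p-smooth, so
-- 4ⁿ ≤ Q ≤ m^p ≤ 2^(ep).
prime-above : ∀ n e → 1 ≤ n → suc (n + n) ≤ 2 ^ e → ∃ λ p → Prime p × p ≤ suc (n + n) × n + n ≤ e * p
prime-above n e 1≤n m≤2^e with largest-prime≤ (suc (n + n)) (s≤s (≤-trans 1≤n (m≤m+n n n)))
... | p , pr , p≤m , max with smooth-multiple (suc (n + n)) (s≤s z≤n) p
...   | Q , 1≤Q , Q≤ , cm = p , pr , p≤m , ≮⇒≥ λ lt → <⇒≱ (^-monoʳ-< 2 (s≤s (s≤s z≤n)) lt) (begin
  2 ^ (n + n)           ≡⟨ ^-distribˡ-+-* 2 n n ⟩
  2 ^ n * 2 ^ n         ≡⟨ ^-distribʳ-* n 2 2 ⟨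
  4 ^ n                 ≤⟨ 4^n≤commonMultiple n {{>-nonZero 1≤Q}} (λ j 1≤j j≤m →
                             cm j 1≤j j≤m λ q pq q∣j → max q pq (≤-trans (∣⇒≤ {{>-nonZero 1≤j}} q∣j) j≤m)) ⟩
  Q                     ≤⟨ Q≤ ⟩
  suc (n + n) ^ p       ≤⟨ ^-monoˡ-≤ p m≤2^e ⟩
  (2 ^ e) ^ p           ≡⟨ ^-*-assoc 2 e p ⟩
  2 ^ (e * p)           ∎)
  where open ≤-Reasoning

-- Sums over lists and the first moment method

private variable
  A B X : Set

∑ : List A → (A → ℕ) → ℕ
∑ []       f = 0
∑ (x ∷ xs) f = f x + ∑ xs f

∑-mono : (xs : List A) {f g : A → ℕ} → (∀ x → f x ≤ g x) → ∑ xs f ≤ ∑ xs g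
∑-mono []       f≤g = z≤n
∑-mono (x ∷ xs) f≤g = +-mono-≤ (f≤g x) (∑-mono xs f≤g)

∑-cong : (xs : List A) {f g : A → ℕ} → (∀ x → f x ≡ g x) → ∑ xs f ≡ ∑ xs g
∑-cong []       f≡g = refl
∑-cong (x ∷ xs) f≡g = cong₂ _+_ (f≡g x) (∑-cong xs f≡g)

∑-distrib-+ : (xs : List A) (f g : A → ℕ) → ∑ xs (λ x → f x + g x) ≡ ∑ xs f + ∑ xs g
∑-distrib-+ []       f g = refl
∑-distrib-+ (x ∷ xs) f g = trans (cong (λ z → f x + g x + z) (∑-distrib-+ xs f g)) (interchange (f x) (g x) _ _)
  where
  interchange : ∀ a b c d → a + b + (c + d) ≡ a + c + (b + d)
  interchange = solve-∀

*-distribˡ-∑ : (xs : List A) (c : ℕ) (f : A → ℕ) → ∑ xs (λ x → c * f x) ≡ c * ∑ xs f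
*-distribˡ-∑ []       c f = sym (*-zeroʳ c)
*-distribˡ-∑ (x ∷ xs) c f = trans (cong (λ z → c * f x + z) (*-distribˡ-∑ xs c f)) (sym (*-distribˡ-+ c (f x) _))

*-distribʳ-∑ : (xs : List A) (c : ℕ) (f : A → ℕ) → ∑ xs (λ x → f x * c) ≡ ∑ xs f * c
*-distribʳ-∑ xs c f = trans (∑-cong xs λ x → *-comm (f x) c) (trans (*-distribˡ-∑ xs c f) (*-comm c _))

∑-const : (xs : List A) (c : ℕ) → ∑ xs (λ _ → c) ≡ length xs * c
∑-const []       c = refl
∑-const (x ∷ xs) c = cong (λ z → c + z) (∑-const xs c)

∑-comm : (xs : List A) (ys : List B) (f : A → B → ℕ) →
  ∑ xs (λ x → ∑ ys (f x)) ≡ ∑ ys (λ y → ∑ xs (λ x → f x y))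
∑-comm []       ys f = sym (trans (∑-const ys 0) (*-zeroʳ (length ys)))
∑-comm (x ∷ xs) ys f = trans (cong (λ z → ∑ ys (f x) + z) (∑-comm xs ys f)) (sym (∑-distrib-+ ys (f x) _))

∑-++ : (xs ys : List A) (f : A → ℕ) → ∑ (xs ++ ys) f ≡ ∑ xs f + ∑ ys f
∑-++ []       ys f = refl
∑-++ (x ∷ xs) ys f = trans (cong (λ z → f x + z) (∑-++ xs ys f)) (sym (+-assoc (f x) _ _))

∑-map : (xs : List A) (g : A → B) (f : B → ℕ) → ∑ (map g xs) f ≡ ∑ xs (f ∘ g)
∑-map []       g f = refl
∑-map (x ∷ xs) g f = cong (λ z → f (g x) + z) (∑-map xs g f)

∑-cartesianProductWith : (g : A → B → X) (xs : List A) (ys : List B) (f : X → ℕ) →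
  ∑ (cartesianProductWith g xs ys) f ≡ ∑ xs (λ x → ∑ ys (λ y → f (g x y)))
∑-cartesianProductWith g []       ys f = refl
∑-cartesianProductWith g (x ∷ xs) ys f = trans (∑-++ (map (g x) ys) _ f)
  (cong₂ _+_ (∑-map ys (g x) f) (∑-cartesianProductWith g xs ys f))

∑-<⇒∃ : (xs : List A) (f g : A → ℕ) → ∑ xs f < ∑ xs g → ∃ λ x → f x < g x
∑-<⇒∃ []       f g ()
∑-<⇒∃ (x ∷ xs) f g lt with f x <? g x
... | yes fx<gx = x , fx<gx
... | no ¬fx<gx = ∑-<⇒∃ xs f g (+-cancelˡ-< (f x) _ _ (<-≤-trans lt (+-monoˡ-≤ _ (≮⇒≥ ¬fx<gx))))

member≤∑ : {xs : List A} {x : A} (f : A → ℕ) → x ∈ xs → f x ≤ ∑ xs f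
member≤∑ f (here refl)  = m≤m+n _ _
member≤∑ f (there x∈xs) = ≤-trans (member≤∑ f x∈xs) (m≤n+m _ _)

2mn≤m²+n² : ∀ m n → 2 * (m * n) ≤ m * m + n * n
2mn≤m²+n² zero    n       = z≤n
2mn≤m²+n² (suc m) zero    = ≤-trans (≤-reflexive (cong (2 *_) (*-zeroʳ m))) z≤n
2mn≤m²+n² (suc m) (suc n) = subst₂ _≤_ (lhs m n) (rhs m n) (+-monoʳ-≤ (2 + 2 * m + 2 * n) (2mn≤m²+n² m n))
  where
  lhs : ∀ m n → 2 + 2 * m + 2 * n + 2 * (m * n) ≡ 2 * ((1 + m) * (1 + n))
  lhs = solve-∀
  rhs : ∀ m n → 2 + 2 * m + 2 * n + (m * m + n * n) ≡ (1 + m) * (1 + m) + (1 + n) * (1 + n)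
  rhs = solve-∀

cauchy-schwarz : (xs : List A) (f : A → ℕ) → ∑ xs f * ∑ xs f ≤ length xs * ∑ xs (λ x → f x * f x)
cauchy-schwarz []       f = z≤n
cauchy-schwarz (x ∷ xs) f = begin
  (f x + T) * (f x + T)                  ≡⟨ expand (f x) T ⟩
  f x * f x + (2 * (f x * T) + T * T)    ≤⟨ +-monoʳ-≤ (f x * f x) (+-mono-≤ cross (cauchy-schwarz xs f)) ⟩
  f x * f x + ((N * (f x * f x) + Q) + N * Q) ≡⟨ collect (f x) Q N ⟩
  (1 + N) * (f x * f x + Q)              ∎
  where
  open ≤-Reasoning
  T = ∑ xs f
  Q = ∑ xs (λ x → f x * f x)
  N = length xs
  expand : ∀ a t → (a + t) * (a + t) ≡ a * a + (2 * (a * t) + t * t)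
  expand = solve-∀
  collect : ∀ a q n → a * a + ((n * (a * a) + q) + n * q) ≡ (1 + n) * (a * a + q)
  collect = solve-∀
  cross : 2 * (f x * T) ≤ N * (f x * f x) + Q
  cross = begin
    2 * (f x * T)                              ≡⟨ *-assoc 2 (f x) T ⟨
    2 * f x * T                                ≡⟨ *-distribˡ-∑ xs (2 * f x) f ⟨
    ∑ xs (λ z → 2 * f x * f z)                 ≤⟨ ∑-mono xs (λ z → ≤-trans (≤-reflexive (*-assoc 2 (f x) (f z))) (2mn≤m²+n² (f x) (f z))) ⟩
    ∑ xs (λ z → f x * f x + f z * f z)         ≡⟨ ∑-distrib-+ xs _ _ ⟩
    ∑ xs (λ _ → f x * f x) + Q                 ≡⟨ cong (_+ Q) (∑-const xs (f x * f x)) ⟩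
    N * (f x * f x) + Q                        ∎

𝟙 : Bool → ℕ
𝟙 true  = 1
𝟙 false = 0

𝟙≤1 : ∀ b → 𝟙 b ≤ 1
𝟙≤1 true  = ≤-refl
𝟙≤1 false = z≤n

𝟙*m≤m : ∀ b m → 𝟙 b * m ≤ m
𝟙*m≤m true  m = ≤-reflexive (+-identityʳ m)
𝟙*m≤m false m = z≤n

∑𝟙≤1 : (xs : List A) (P : A → Bool) → Unique xs →
  (∀ x y → P x ≡ true → P y ≡ true → x ≡ y) → ∑ xs (𝟙 ∘ P) ≤ 1
∑𝟙≤1 []       P _          one = z≤n
∑𝟙≤1 (x ∷ xs) P (x∉ ∷ uniq) one with P x in Px
... | false = ∑𝟙≤1 xs P uniq one
... | true  = ≤-reflexive (cong suc (rest xs x∉))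
  where
  rest : ∀ zs → All (λ z → ¬ x ≡ z) zs → ∑ zs (𝟙 ∘ P) ≡ 0
  rest []       []          = refl
  rest (z ∷ zs) (x≢z ∷ x∉) with P z in Pz
  ... | true  = contradiction (one x z Px Pz) x≢z
  ... | false = rest zs x∉

-- The first moment method for random n-tuples drawn independently from a
-- weighted list, with the independent k-subsequences recognised by a deterministic
-- automaton and counted with the help of a potential φ on its states.
module FirstMoment
  {U St : Set} (us : List U) (w : U → ℕ)
  (ok : St → U → Bool) (next : St → U → St)
  where

  W : ℕ
  W = ∑ us w

  -- The two summands skip and take the first entry; a skipped entry leaves the state alone.
  accepted : ∀ {n} → Vec U n → ℕ → St → ℕ
  accepted []      zero    σ = 1
  accepted []      (suc k) σ = 0
  accepted (v ∷ ω) zero    σ = 1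
  accepted (v ∷ ω) (suc k) σ = accepted ω (suc k) σ + 𝟙 (ok σ v) * accepted ω k (next σ v)

  -- An unnormalised expectation: division by `W ^ n` would give the mean over independent draws
  -- with probabilities proportional to `w`.
  total : ∀ n → (Vec U n → ℕ) → ℕ
  total zero    f = f []
  total (suc n) f = ∑ us λ v → w v * total n (f ∘ (v ∷_))

  -- A mean below 1 of a function with values in ℕ forces the value 0. The entries are fixed one by
  -- one, and an entry of weight 0 cannot be picked because both sides of the strict inequality
  -- would vanish.
  total<W^n⇒∃ : ∀ n (f : Vec U n → ℕ) → total n f < W ^ n →
    ∃ λ ω → f ω ≡ 0 × VAll.All (λ v → ¬ w v ≡ 0) ω
  total<W^n⇒∃ zero    f lt = [] , n<1⇒n≡0 lt , []
  total<W^n⇒∃ (suc n) f lt with ∑-<⇒∃ us _ (λ v → w v * W ^ n) (<-≤-trans lt (≤-reflexive (sym (*-distribʳ-∑ us (W ^ n) w))))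
  ... | v , lt-v with total<W^n⇒∃ n (f ∘ (v ∷_)) (*-cancelˡ-< (w v) _ _ lt-v)
  ...   | ω , fω≡0 , ωs = v ∷ ω , fω≡0 , (λ wv≡0 → <⇒≱ lt-v (subst (λ z → z * W ^ n ≤ w v * total n (f ∘ (v ∷_))) (sym wv≡0) z≤n)) ∷ ωs

  total-cong : ∀ n {f g : Vec U n → ℕ} → (∀ ω → f ω ≡ g ω) → total n f ≡ total n g
  total-cong zero    f≡g = f≡g []
  total-cong (suc n) f≡g = ∑-cong us λ v → cong (w v *_) (total-cong n λ ω → f≡g (v ∷ ω))

  total-+ : ∀ n (f g : Vec U n → ℕ) → total n (λ ω → f ω + g ω) ≡ total n f + total n g
  total-+ zero    f g = refl
  total-+ (suc n) f g = trans
    (∑-cong us λ v → trans (cong (w v *_) (total-+ n (f ∘ (v ∷_)) (g ∘ (v ∷_)))) (*-distribˡ-+ (w v) _ _))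
    (∑-distrib-+ us _ _)

  total-* : ∀ n c (f : Vec U n → ℕ) → total n (λ ω → c * f ω) ≡ c * total n f
  total-* zero    c f = refl
  total-* (suc n) c f = trans
    (∑-cong us λ v → trans (cong (w v *_) (total-* n c (f ∘ (v ∷_)))) (swap (w v) c _))
    (*-distribˡ-∑ us c _)
    where
    swap : ∀ a b x → a * (b * x) ≡ b * (a * x)
    swap = solve-∀

  total-1 : ∀ n → total n (λ _ → 1) ≡ W ^ n
  total-1 zero    = refl
  total-1 (suc n) = trans (∑-cong us λ v → cong (w v *_) (total-1 n)) (*-distribʳ-∑ us (W ^ n) w)

  total-suc : ∀ n k σ → total (suc n) (λ ω → accepted ω (suc k) σ) ≡
    W * total n (λ ω → accepted ω (suc k) σ) +
    ∑ us (λ v → w v * (𝟙 (ok σ v) * total n (λ ω → accepted ω k (next σ v))))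
  total-suc n k σ = begin
    ∑ us (λ v → w v * total n (λ ω → accepted ω (suc k) σ + 𝟙 (ok σ v) * accepted ω k (next σ v)))
      ≡⟨ (∑-cong us λ v → trans (cong (w v *_) (trans (total-+ n _ _) (cong (λ z → total n _ + z) (total-* n (𝟙 (ok σ v)) _)))) (*-distribˡ-+ (w v) _ _)) ⟩
    ∑ us (λ v → w v * total n (λ ω → accepted ω (suc k) σ) + w v * (𝟙 (ok σ v) * total n (λ ω → accepted ω k (next σ v))))
      ≡⟨ ∑-distrib-+ us _ _ ⟩
    ∑ us (λ v → w v * total n (λ ω → accepted ω (suc k) σ)) + E
      ≡⟨ cong (_+ E) (*-distribʳ-∑ us _ w) ⟩
    W * total n (λ ω → accepted ω (suc k) σ) + E ∎
    where
    open ≡-Reasoning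
    E = ∑ us (λ v → w v * (𝟙 (ok σ v) * total n (λ ω → accepted ω k (next σ v))))

  accepted-0 : ∀ {n} (ω : Vec U n) σ → accepted ω 0 σ ≡ 1
  accepted-0 []      σ = refl
  accepted-0 (v ∷ ω) σ = refl

  -- `step` says that the weighted potential grows by at most a factor `C` per accepted entry. The
  -- last entry needs its own hypothesis: the count left after it is 1, which `φ` of the next state
  -- need not dominate, since it may be 0.
  module _ (φ : St → ℕ) (C : ℕ)
    (last-step : ∀ σ → ∑ us (λ v → w v * 𝟙 (ok σ v)) ≤ C * φ σ)
    (step      : ∀ σ → ∑ us (λ v → w v * (𝟙 (ok σ v) * φ (next σ v))) ≤ C * φ σ)
    where

    n^[1+k]+n^k≤ : ∀ n k → n ^ suc k + n ^ k ≤ suc n ^ suc k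
    n^[1+k]+n^k≤ n k = begin
      n * n ^ k + n ^ k     ≡⟨ +-comm (n * n ^ k) (n ^ k) ⟩
      suc n * n ^ k         ≤⟨ *-monoʳ-≤ (suc n) (^-monoˡ-≤ k (n≤1+n n)) ⟩
      suc n * suc n ^ k     ∎
      where open ≤-Reasoning

    -- With K = k + 1, the mean number of accepted K-subsequences is at most n^K (C/W)^K φ(σ). Here
    -- n^K stands in for the binomial coefficient; `n^[1+k]+n^k≤` takes the place of Pascal's rule
    -- when the first entry is split off.
    total-accepted-bound : ∀ n k σ →
      total n (λ ω → accepted ω (suc k) σ) * W ^ suc k ≤ n ^ suc k * (W ^ n * (C ^ suc k * φ σ))

    extensions-bound : ∀ n k σ →
      ∑ us (λ v → w v * (𝟙 (ok σ v) * total n (λ ω → accepted ω k (next σ v)))) * W ^ k ≤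
      n ^ k * (W ^ n * (C ^ k * (C * φ σ)))

    total-accepted-bound zero    k σ = z≤n
    total-accepted-bound (suc n) k σ = begin
      total (suc n) (λ ω → accepted ω (suc k) σ) * W ^ suc k
        ≡⟨ cong (_* W ^ suc k) (total-suc n k σ) ⟩
      (W * T + E) * (W * W ^ k)
        ≡⟨ expand W T E (W ^ k) ⟩
      W * (T * (W * W ^ k) + E * W ^ k)
        ≤⟨ *-monoʳ-≤ W (+-mono-≤ (total-accepted-bound n k σ) (extensions-bound n k σ)) ⟩
      W * (n ^ suc k * (W ^ n * (C * C ^ k * φ σ)) + n ^ k * (W ^ n * (C ^ k * (C * φ σ))))
        ≡⟨ collect W (n ^ suc k) (n ^ k) (W ^ n) C (C ^ k) (φ σ) ⟩
      (n ^ suc k + n ^ k) * (W * W ^ n * (C * C ^ k * φ σ))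
        ≤⟨ *-monoˡ-≤ _ (n^[1+k]+n^k≤ n k) ⟩
      suc n ^ suc k * (W ^ suc n * (C ^ suc k * φ σ)) ∎
      where
      open ≤-Reasoning
      T = total n (λ ω → accepted ω (suc k) σ)
      E = ∑ us (λ v → w v * (𝟙 (ok σ v) * total n (λ ω → accepted ω k (next σ v))))
      expand : ∀ W T E V → (W * T + E) * (W * V) ≡ W * (T * (W * V) + E * V)
      expand = solve-∀
      collect : ∀ W a b V C K f → W * (a * (V * (C * K * f)) + b * (V * (K * (C * f)))) ≡ (a + b) * (W * V * (C * K * f))
      collect = solve-∀

    extensions-bound n zero σ = begin
      ∑ us (λ v → w v * (𝟙 (ok σ v) * total n (λ ω → accepted ω 0 (next σ v)))) * 1
        ≡⟨ *-identityʳ _ ⟩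
      ∑ us (λ v → w v * (𝟙 (ok σ v) * total n (λ ω → accepted ω 0 (next σ v))))
        ≡⟨ (∑-cong us λ v → trans (cong (λ z → w v * (𝟙 (ok σ v) * z)) (trans (total-cong n λ ω → accepted-0 ω (next σ v)) (total-1 n)))
             (sym (*-assoc (w v) _ _))) ⟩
      ∑ us (λ v → w v * 𝟙 (ok σ v) * W ^ n)
        ≡⟨ *-distribʳ-∑ us (W ^ n) _ ⟩
      ∑ us (λ v → w v * 𝟙 (ok σ v)) * W ^ n
        ≤⟨ *-monoˡ-≤ (W ^ n) (last-step σ) ⟩
      C * φ σ * W ^ n
        ≡⟨ arrange (C * φ σ) (W ^ n) ⟩
      1 * (W ^ n * (1 * (C * φ σ))) ∎
      where
      open ≤-Reasoning
      arrange : ∀ a b → a * b ≡ 1 * (b * (1 * a))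
      arrange = solve-∀
    extensions-bound n (suc k) σ = begin
      ∑ us (λ v → w v * (𝟙 (ok σ v) * total n (λ ω → accepted ω (suc k) (next σ v)))) * W ^ suc k
        ≡⟨ *-distribʳ-∑ us (W ^ suc k) _ ⟨
      ∑ us (λ v → w v * (𝟙 (ok σ v) * total n (λ ω → accepted ω (suc k) (next σ v))) * W ^ suc k)
        ≤⟨ (∑-mono us λ v → ≤-trans (≤-reflexive (assoc (w v) (𝟙 (ok σ v)) _ (W ^ suc k)))
             (*-monoʳ-≤ (w v) (*-monoʳ-≤ (𝟙 (ok σ v)) (total-accepted-bound n k (next σ v))))) ⟩
      ∑ us (λ v → w v * (𝟙 (ok σ v) * (n ^ suc k * (W ^ n * (C ^ suc k * φ (next σ v))))))
        ≡⟨ (∑-cong us λ v → pull (w v) (𝟙 (ok σ v)) (n ^ suc k) (W ^ n) (C ^ suc k) (φ (next σ v))) ⟩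
      ∑ us (λ v → n ^ suc k * (W ^ n * C ^ suc k) * (w v * (𝟙 (ok σ v) * φ (next σ v))))
        ≡⟨ *-distribˡ-∑ us (n ^ suc k * (W ^ n * C ^ suc k)) _ ⟩
      n ^ suc k * (W ^ n * C ^ suc k) * ∑ us (λ v → w v * (𝟙 (ok σ v) * φ (next σ v)))
        ≤⟨ *-monoʳ-≤ (n ^ suc k * (W ^ n * C ^ suc k)) (step σ) ⟩
      n ^ suc k * (W ^ n * C ^ suc k) * (C * φ σ)
        ≡⟨ assoc (n ^ suc k) (W ^ n) (C ^ suc k) (C * φ σ) ⟩
      n ^ suc k * (W ^ n * (C ^ suc k * (C * φ σ))) ∎
      where
      open ≤-Reasoning
      assoc : ∀ a b c d → a * (b * c) * d ≡ a * (b * (c * d))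
      assoc = solve-∀
      pull : ∀ w i a b c f → w * (i * (a * (b * (c * f)))) ≡ a * (b * c) * (w * (i * f))
      pull = solve-∀

    ∃-none-accepted : ∀ n k σ → n ^ suc k * (C ^ suc k * φ σ) < W ^ suc k →
      ∃ λ ω → accepted {n} ω (suc k) σ ≡ 0 × VAll.All (λ v → ¬ w v ≡ 0) ω
    ∃-none-accepted n k σ small = total<W^n⇒∃ n _ (*-cancelʳ-< (W ^ suc k) _ _ (begin-strict
      total n (λ ω → accepted ω (suc k) σ) * W ^ suc k     ≤⟨ total-accepted-bound n k σ ⟩
      n ^ suc k * (W ^ n * (C ^ suc k * φ σ))              ≡⟨ swap (n ^ suc k) (W ^ n) _ ⟩
      W ^ n * (n ^ suc k * (C ^ suc k * φ σ))              <⟨ *-monoʳ-< (W ^ n) {{W^n≢0}} small ⟩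
      W ^ n * W ^ suc k                                    ∎))
      where
      open ≤-Reasoning
      swap : ∀ a b x → a * (b * x) ≡ b * (a * x)
      swap = solve-∀
      W≢0 : NonZero W
      W≢0 = ≢-nonZero λ W≡0 → <⇒≱ (subst (λ z → _ < z ^ suc k) W≡0 small) z≤n
      W^n≢0 : NonZero (W ^ n)
      W^n≢0 = m^n≢0 W n {{W≢0}}

-- Scalar products over the field with p elements

does-true : ∀ {P : Set} (d : Dec P) → does d ≡ true → P
does-true (yes p) _ = p

true-does : ∀ {P : Set} (d : Dec P) → P → does d ≡ true
true-does (yes _) _ = refl
true-does (no ¬p) p = contradiction p ¬p

module PrimeField (p′ : ℕ) (prime-p : Prime (suc p′)) where

  p : ℕ
  p = suc p′

  abstract
    residue : ℕ → Fin p
    residue m = m mod p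

    toℕ-residue : ∀ m → toℕ (residue m) ≡ m ℕ.% p
    toℕ-residue m = Fin.toℕ-fromℕ< (m%n<n m p)

  residue-∣ : ∀ m n → residue m ≡ residue n → (+ p) ℤ.∣ (+ m ℤ.- + n)
  residue-∣ m n eq = ℤ.divides (+ (m ℕ./ p) ℤ.- + (n ℕ./ p)) (begin
    + m ℤ.- + n
      ≡⟨ cong₂ (λ a b → + a ℤ.- + b) (m≡m%n+[m/n]*n m p) (m≡m%n+[m/n]*n n p) ⟩
    + (m ℕ.% p + m ℕ./ p * p) ℤ.- + (n ℕ.% p + n ℕ./ p * p)
      ≡⟨ cong (λ z → + (z + m ℕ./ p * p) ℤ.- + (n ℕ.% p + n ℕ./ p * p)) rem-eq ⟩
    + (n ℕ.% p + m ℕ./ p * p) ℤ.- + (n ℕ.% p + n ℕ./ p * p)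
      ≡⟨ cancel (n ℕ.% p) (m ℕ./ p) (n ℕ./ p) p ⟩
    (+ (m ℕ./ p) ℤ.- + (n ℕ./ p)) ℤ.* + p ∎)
    where
    open ≡-Reasoning
    rem-eq : m ℕ.% p ≡ n ℕ.% p
    rem-eq = trans (sym (toℕ-residue m)) (trans (cong toℕ eq) (toℕ-residue n))
    ring : ∀ r a b p → (r ℤ.+ a ℤ.* p) ℤ.- (r ℤ.+ b ℤ.* p) ≡ (a ℤ.- b) ℤ.* p
    ring = ℤ-Solver.solve-∀
    cast : ∀ r q p → + (r + q * p) ≡ + r ℤ.+ + q ℤ.* + p
    cast r q p = trans (ℤ.pos-+ r (q * p)) (cong (ℤ._+_ (+ r)) (ℤ.pos-* q p))
    cancel : ∀ r a b p → + (r + a * p) ℤ.- + (r + b * p) ≡ (+ a ℤ.- + b) ℤ.* + p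
    cancel r a b p = trans (cong₂ ℤ._-_ (cast r a p) (cast r b p)) (ring (+ r) (+ a) (+ b) (+ p))

  euclid-ℤ : ∀ x y → (+ p) ℤ.∣ (x ℤ.* y) → (+ p) ℤ.∣ x ⊎ (+ p) ℤ.∣ y
  euclid-ℤ x y p∣xy with euclidsLemma ℤ.∣ x ∣ ℤ.∣ y ∣ prime-p (subst (p ∣_) (ℤ.abs-* x y) (ℤ.∣⇒∣ᵤ p∣xy))
  ... | inj₁ p∣x = inj₁ (ℤ.∣ᵤ⇒∣ p∣x)
  ... | inj₂ p∣y = inj₂ (ℤ.∣ᵤ⇒∣ p∣y)

  ∣digit-difference : ∀ (x y : Fin p) → (+ p) ℤ.∣ (+ toℕ x ℤ.- + toℕ y) → x ≡ y
  ∣digit-difference x y p∣ = Fin.toℕ-injective (ℤ.+-injective (ℤ.i-j≡0⇒i≡j _ _ (ℤ.∣i∣≡0⇒i≡0 (small _ abs< (ℤ.∣⇒∣ᵤ p∣)))))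
    where
    small : ∀ n → n < p → p ∣ n → n ≡ 0
    small zero    _   _   = refl
    small (suc n) n<p p∣n = contradiction (∣⇒≤ p∣n) (<⇒≱ n<p)
    abs< : ℤ.∣ + toℕ x ℤ.- + toℕ y ∣ < p
    abs< = ≤-<-trans (subst (λ z → ℤ.∣ z ∣ ≤ toℕ x ⊔ toℕ y) (sym (ℤ.m-n≡m⊖n (toℕ x) (toℕ y))) (ℤ.∣m⊝n∣≤m⊔n (toℕ x) (toℕ y)))
             (⊔-lub (Fin.toℕ<n x) (Fin.toℕ<n y))

  V : ℕ → Set
  V = Vec (Fin p)

  vectors : ∀ D → List (V D)
  vectors zero    = [] ∷ []
  vectors (suc D) = cartesianProductWith _∷_ (allFin p) (vectors D)

  dot : ∀ {D} → V D → V D → ℕ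
  dot []      []      = 0
  dot (x ∷ a) (t ∷ y) = toℕ x * toℕ t + dot a y

  ⟨_,_⟩ : ∀ {D} → V D → V D → Fin p
  ⟨ a , y ⟩ = residue (dot a y)

  ∑-vectors-suc : ∀ D (f : V (suc D) → ℕ) →
    ∑ (vectors (suc D)) f ≡ ∑ (allFin p) λ x → ∑ (vectors D) λ a → f (x ∷ a)
  ∑-vectors-suc D f = ∑-cartesianProductWith _∷_ (allFin p) (vectors D) f

  ∑-allFin-const : ∀ c → ∑ (allFin p) (λ _ → c) ≡ p * c
  ∑-allFin-const c = trans (∑-const (allFin p) c) (cong (_* c) (length-tabulate {n = p} (λ i → i)))

  ∑-vectors-const : ∀ D c → ∑ (vectors D) (λ _ → c) ≡ p ^ D * c
  ∑-vectors-const zero    c = refl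
  ∑-vectors-const (suc D) c = begin
    ∑ (vectors (suc D)) (λ _ → c)                       ≡⟨ ∑-vectors-suc D (λ _ → c) ⟩
    ∑ (allFin p) (λ _ → ∑ (vectors D) (λ _ → c))        ≡⟨ ∑-cong (allFin p) (λ _ → ∑-vectors-const D c) ⟩
    ∑ (allFin p) (λ _ → p ^ D * c)                      ≡⟨ ∑-allFin-const (p ^ D * c) ⟩
    p * (p ^ D * c)                                     ≡⟨ *-assoc p (p ^ D) c ⟨
    p * p ^ D * c                                       ∎
    where open ≡-Reasoning

  vectors-unique : ∀ D → Unique (vectors D)
  vectors-unique zero    = [] ∷ []
  vectors-unique (suc D) = Unique.cartesianProductWith⁺ _∷_ Vec.∷-injective (Unique.allFin⁺ p) (vectors-unique D)

  -- The constants `c` and `c′` collect the contributions of coordinates already fixed; without them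
  -- the induction on the dimension would not close.
  affine-agree : ∀ {D} → ℕ → ℕ → V D → V D → V D → Bool
  affine-agree c c′ y y′ a = does (residue (c + dot a y) Fin.≟ residue (c′ + dot a y′))

  -- Subtracting the equations for two solutions x and z gives p ∣ (x - z)(t - t′). By Euclid's
  -- lemma p divides a factor, and digits congruent modulo p are equal.
  one-digit : ∀ c c′ (t t′ : Fin p) d d′ → ¬ t ≡ t′ →
    ∑ (allFin p) (λ x → 𝟙 (does (residue (c + (toℕ x * toℕ t + d)) Fin.≟ residue (c′ + (toℕ x * toℕ t′ + d′))))) ≤ 1
  one-digit c c′ t t′ d d′ t≢t′ = ∑𝟙≤1 (allFin p) (does ∘ solution?) (Unique.allFin⁺ p) λ x z ex ez →
    unique x z (does-true (solution? x) ex) (does-true (solution? z) ez)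
    where
    val : ℕ → ℕ → Fin p → Fin p → ℕ
    val c d t x = c + (toℕ x * toℕ t + d)
    solution? : ∀ x → Dec (residue (val c d t x) ≡ residue (val c′ d′ t′ x))
    solution? x = residue (val c d t x) Fin.≟ residue (val c′ d′ t′ x)
    regroup : ∀ c x t d → c + (x * t + d) ≡ (c + d) + x * t
    regroup = solve-∀
    cast : ∀ c x t d → + (c + (x * t + d)) ≡ + (c + d) ℤ.+ + x ℤ.* + t
    cast c x t d = trans (cong +_ (regroup c x t d)) (trans (ℤ.pos-+ (c + d) (x * t)) (cong (ℤ._+_ (+ (c + d))) (ℤ.pos-* x t)))
    cancel : ∀ k x z t → (k ℤ.+ x ℤ.* t) ℤ.- (k ℤ.+ z ℤ.* t) ≡ (x ℤ.- z) ℤ.* t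
    cancel = ℤ-Solver.solve-∀
    interchange : ∀ a b c d → (a ℤ.- b) ℤ.- (c ℤ.- d) ≡ (a ℤ.- c) ℤ.- (b ℤ.- d)
    interchange = ℤ-Solver.solve-∀
    factor : ∀ u t t′ → u ℤ.* t ℤ.- u ℤ.* t′ ≡ u ℤ.* (t ℤ.- t′)
    factor = ℤ-Solver.solve-∀
    slope : ∀ c d x z t → + (c + (x * t + d)) ℤ.- + (c + (z * t + d)) ≡ (+ x ℤ.- + z) ℤ.* + t
    slope c d x z t = trans (cong₂ ℤ._-_ (cast c x t d) (cast c z t d)) (cancel (+ (c + d)) (+ x) (+ z) (+ t))
    difference : ∀ c c′ d d′ x z t t′ →
      (+ (c + (x * t + d)) ℤ.- + (c′ + (x * t′ + d′))) ℤ.- (+ (c + (z * t + d)) ℤ.- + (c′ + (z * t′ + d′))) ≡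
      (+ x ℤ.- + z) ℤ.* (+ t ℤ.- + t′)
    difference c c′ d d′ x z t t′ = trans
      (interchange (+ (c + (x * t + d))) (+ (c′ + (x * t′ + d′))) (+ (c + (z * t + d))) (+ (c′ + (z * t′ + d′))))
      (trans (cong₂ ℤ._-_ (slope c d x z t) (slope c′ d′ x z t′)) (factor (+ x ℤ.- + z) (+ t) (+ t′)))
    unique : ∀ x z → residue (val c d t x) ≡ residue (val c′ d′ t′ x) → residue (val c d t z) ≡ residue (val c′ d′ t′ z) → x ≡ z
    unique x z ex ez = [ ∣digit-difference x z , (λ p∣ → contradiction (∣digit-difference t t′ p∣) t≢t′) ]′
      (euclid-ℤ (+ toℕ x ℤ.- + toℕ z) (+ toℕ t ℤ.- + toℕ t′)
        (subst ((+ p) ℤ.∣_) (difference c c′ d d′ (toℕ x) (toℕ z) (toℕ t) (toℕ t′))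
          (ℤ.∣m∣n⇒∣m-n (residue-∣ (val c d t x) (val c′ d′ t′ x) ex) (residue-∣ (val c d t z) (val c′ d′ t′ z) ez))))

  -- If the tails of y and y′ differ, the first coordinate of a is fixed and moved into the
  -- constants. If they agree, the heads differ, and each tail of a admits at most one first
  -- coordinate.
  affine-agree-count : ∀ D c c′ (y y′ : V (suc D)) → ¬ y ≡ y′ →
    ∑ (vectors (suc D)) (𝟙 ∘ affine-agree c c′ y y′) ≤ p ^ D
  affine-agree-count D c c′ (t ∷ y) (t′ ∷ y′) y≢y′ with Vec.≡-dec Fin._≟_ y y′
  ... | yes refl = begin
    ∑ (vectors (suc D)) (𝟙 ∘ affine-agree c c′ (t ∷ y) (t′ ∷ y))
      ≡⟨ ∑-vectors-suc D _ ⟩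
    ∑ (allFin p) (λ x → ∑ (vectors D) (λ a → 𝟙 (affine-agree c c′ (t ∷ y) (t′ ∷ y) (x ∷ a))))
      ≡⟨ ∑-comm (allFin p) (vectors D) _ ⟩
    ∑ (vectors D) (λ a → ∑ (allFin p) (λ x → 𝟙 (affine-agree c c′ (t ∷ y) (t′ ∷ y) (x ∷ a))))
      ≤⟨ ∑-mono (vectors D) (λ a → one-digit c c′ t t′ (dot a y) (dot a y) λ { refl → y≢y′ refl }) ⟩
    ∑ (vectors D) (λ _ → 1)
      ≡⟨ trans (∑-vectors-const D 1) (*-identityʳ (p ^ D)) ⟩
    p ^ D ∎
    where open ≤-Reasoning
  affine-agree-count zero c c′ (t ∷ []) (t′ ∷ []) y≢y′ | no []≢[] = contradiction refl []≢[]
  affine-agree-count (suc D) c c′ (t ∷ y) (t′ ∷ y′) _ | no y≢y′ = begin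
    ∑ (vectors (suc (suc D))) (𝟙 ∘ affine-agree c c′ (t ∷ y) (t′ ∷ y′))
      ≡⟨ ∑-vectors-suc (suc D) _ ⟩
    ∑ (allFin p) (λ x → ∑ (vectors (suc D)) (λ a → 𝟙 (affine-agree c c′ (t ∷ y) (t′ ∷ y′) (x ∷ a))))
      ≡⟨ (∑-cong (allFin p) λ x → ∑-cong (vectors (suc D)) λ a →
           cong₂ (λ m n → 𝟙 (does (residue m Fin.≟ residue n))) (sym (+-assoc c _ _)) (sym (+-assoc c′ _ _))) ⟩
    ∑ (allFin p) (λ x → ∑ (vectors (suc D)) (𝟙 ∘ affine-agree (c + toℕ x * toℕ t) (c′ + toℕ x * toℕ t′) y y′))
      ≤⟨ ∑-mono (allFin p) (λ x → affine-agree-count D (c + toℕ x * toℕ t) (c′ + toℕ x * toℕ t′) y y′ y≢y′) ⟩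
    ∑ (allFin p) (λ _ → p ^ D)
      ≡⟨ ∑-allFin-const (p ^ D) ⟩
    p ^ suc D ∎
    where open ≤-Reasoning

  agree-count : ∀ D (y y′ : V (suc D)) → ¬ y ≡ y′ →
    ∑ (vectors (suc D)) (λ a → 𝟙 (does (⟨ a , y ⟩ Fin.≟ ⟨ a , y′ ⟩))) ≤ p ^ D
  agree-count D = affine-agree-count D 0 0

-- Counting independent sequences

-- Bernoulli's inequality (1 + 1/m)^j ≥ 1 + j/m at j = m. It will be used with m = 2p - 1: that many
-- reductions by the factor 1 - 1/(2p) at least halve a quantity.
[1+m]^m≥2m^m : ∀ m .{{_ : NonZero m}} → 2 * m ^ m ≤ suc m ^ m
[1+m]^m≥2m^m m = *-cancelʳ-≤ _ _ m (≤-trans (≤-reflexive (double m (m ^ m))) (bernoulli m))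
  where
  open ≤-Reasoning
  double : ∀ m q → 2 * q * m ≡ q * (m + m)
  double = solve-∀
  assoc : ∀ a b c → a * b * c ≡ a * (b * c)
  assoc = solve-∀
  split : ∀ m j q → (1 + m) * (q * (m + j)) ≡ m * q * (m + (1 + j)) + q * j
  split = solve-∀
  bernoulli : ∀ j → m ^ j * (m + j) ≤ suc m ^ j * m
  bernoulli zero    = ≤-reflexive (cong (1 *_) (+-identityʳ m))
  bernoulli (suc j) = begin
    m * m ^ j * (m + suc j)                ≤⟨ m≤m+n _ (m ^ j * j) ⟩
    m * m ^ j * (m + suc j) + m ^ j * j    ≡⟨ split m j (m ^ j) ⟨
    suc m * (m ^ j * (m + j))              ≤⟨ *-monoʳ-≤ (suc m) (bernoulli j) ⟩
    suc m * (suc m ^ j * m)                ≡⟨ assoc (suc m) (suc m ^ j) m ⟨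
    suc m * suc m ^ j * m                  ∎

module Counting (p′ : ℕ) (prime-p : Prime (suc p′)) (D : ℕ) where
  open PrimeField p′ prime-p

  d : ℕ
  d = suc D

  size : (V d → Bool) → ℕ
  size B = ∑ (vectors d) (𝟙 ∘ B)

  size≤ : ∀ B → size B ≤ p ^ d
  size≤ B = ≤-trans (∑-mono (vectors d) (𝟙≤1 ∘ B)) (≤-reflexive (trans (∑-vectors-const d 1) (*-identityʳ (p ^ d))))

  orthogonal : V d → V d → Bool
  orthogonal a y = does (⟨ a , y ⟩ Fin.≟ zero)

  restrict : (V d → Bool) → V d → V d → Bool
  restrict B a y = B y ∧ not (orthogonal a y)

  zeros : (V d → Bool) → V d → ℕ
  zeros B a = ∑ (vectors d) λ y → 𝟙 (B y) * 𝟙 (orthogonal a y)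

  size-restrict : ∀ B a → size (restrict B a) + zeros B a ≡ size B
  size-restrict B a = trans (sym (∑-distrib-+ (vectors d) _ _)) (∑-cong (vectors d) λ y → split (B y) (orthogonal a y))
    where
    split : ∀ b o → 𝟙 (b ∧ not o) + 𝟙 b * 𝟙 o ≡ 𝟙 b
    split true  true  = refl
    split true  false = refl
    split false o     = refl

  agree-count′ : ∀ y y′ → ∑ (vectors d) (λ a → 𝟙 (does (⟨ a , y ⟩ Fin.≟ ⟨ a , y′ ⟩))) ≤
    p ^ D + 𝟙 (does (Vec.≡-dec Fin._≟_ y y′)) * p ^ d
  agree-count′ y y′ with Vec.≡-dec Fin._≟_ y y′
  ... | no y≢y′ = ≤-trans (agree-count D y y′ y≢y′) (m≤m+n (p ^ D) 0)
  ... | yes _   = ≤-trans (size≤ _) (≤-trans (m≤m+n (p ^ d) 0) (m≤n+m (1 * p ^ d) (p ^ D)))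

  module _ (B : V d → Bool) where

    S : ℕ
    S = size B

    collisions : V d → ℕ
    collisions a = ∑ (vectors d) λ y → ∑ (vectors d) λ y′ → 𝟙 (B y) * (𝟙 (B y′) * 𝟙 (does (⟨ a , y ⟩ Fin.≟ ⟨ a , y′ ⟩)))

    -- Distinct y and y′ collide for at most a fraction 1/p of all a, equal ones for every a. The
    -- mean over a is thus at most S²/p + S, only S above the minimum S²/p that Cauchy-Schwarz
    -- imposes on each single a.
    total-collisions : ∑ (vectors d) collisions ≤ S * S * p ^ D + S * p ^ d
    total-collisions = begin
      ∑ Vs (λ a → ∑ Vs λ y → ∑ Vs λ y′ → 𝟙 (B y) * (𝟙 (B y′) * eq a y y′))
        ≡⟨ ∑-comm Vs Vs _ ⟩
      ∑ Vs (λ y → ∑ Vs λ a → ∑ Vs λ y′ → 𝟙 (B y) * (𝟙 (B y′) * eq a y y′))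
        ≡⟨ ∑-cong Vs (λ y → ∑-comm Vs Vs _) ⟩
      ∑ Vs (λ y → ∑ Vs λ y′ → ∑ Vs λ a → 𝟙 (B y) * (𝟙 (B y′) * eq a y y′))
        ≡⟨ (∑-cong Vs λ y → ∑-cong Vs λ y′ → trans (*-distribˡ-∑ Vs (𝟙 (B y)) _) (cong (𝟙 (B y) *_) (*-distribˡ-∑ Vs (𝟙 (B y′)) _))) ⟩
      ∑ Vs (λ y → ∑ Vs λ y′ → 𝟙 (B y) * (𝟙 (B y′) * ∑ Vs λ a → eq a y y′))
        ≤⟨ (∑-mono Vs λ y → ∑-mono Vs λ y′ → *-monoʳ-≤ (𝟙 (B y)) (bound y y′)) ⟩
      ∑ Vs (λ y → ∑ Vs λ y′ → 𝟙 (B y) * (𝟙 (B y′) * p ^ D + same y y′ * p ^ d))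
        ≡⟨ (∑-cong Vs λ y → trans (*-distribˡ-∑ Vs (𝟙 (B y)) _) (cong (𝟙 (B y) *_)
             (trans (∑-distrib-+ Vs _ _) (cong₂ _+_ (*-distribʳ-∑ Vs (p ^ D) _) (*-distribʳ-∑ Vs (p ^ d) _))))) ⟩
      ∑ Vs (λ y → 𝟙 (B y) * (S * p ^ D + ∑ Vs (same y) * p ^ d))
        ≤⟨ (∑-mono Vs λ y → *-monoʳ-≤ (𝟙 (B y)) (+-monoʳ-≤ (S * p ^ D) (*-monoˡ-≤ (p ^ d) (same≤1 y)))) ⟩
      ∑ Vs (λ y → 𝟙 (B y) * (S * p ^ D + 1 * p ^ d))
        ≡⟨ *-distribʳ-∑ Vs _ _ ⟩
      S * (S * p ^ D + 1 * p ^ d)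
        ≡⟨ expand S (p ^ D) (p ^ d) ⟩
      S * S * p ^ D + S * p ^ d ∎
      where
      open ≤-Reasoning
      Vs = vectors d
      eq : V d → V d → V d → ℕ
      eq a y y′ = 𝟙 (does (⟨ a , y ⟩ Fin.≟ ⟨ a , y′ ⟩))
      same : V d → V d → ℕ
      same y y′ = 𝟙 (does (Vec.≡-dec Fin._≟_ y y′))
      same≤1 : ∀ y → ∑ Vs (same y) ≤ 1
      same≤1 y = ∑𝟙≤1 Vs _ (vectors-unique d) λ u v eu ev →
        trans (sym (does-true (Vec.≡-dec Fin._≟_ y u) eu)) (does-true (Vec.≡-dec Fin._≟_ y v) ev)
      bound : ∀ y y′ → 𝟙 (B y′) * ∑ Vs (λ a → eq a y y′) ≤ 𝟙 (B y′) * p ^ D + same y y′ * p ^ d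
      bound y y′ = begin
        𝟙 (B y′) * ∑ Vs (λ a → eq a y y′)                       ≤⟨ *-monoʳ-≤ (𝟙 (B y′)) (agree-count′ y y′) ⟩
        𝟙 (B y′) * (p ^ D + same y y′ * p ^ d)                  ≡⟨ *-distribˡ-+ (𝟙 (B y′)) (p ^ D) _ ⟩
        𝟙 (B y′) * p ^ D + 𝟙 (B y′) * (same y y′ * p ^ d)       ≤⟨ +-monoʳ-≤ (𝟙 (B y′) * p ^ D) (𝟙*m≤m (B y′) _) ⟩
        𝟙 (B y′) * p ^ D + same y y′ * p ^ d                    ∎
      expand : ∀ s a b → s * (s * a + 1 * b) ≡ s * s * a + s * b
      expand = solve-∀

    fibre : V d → Fin p → ℕ
    fibre a t = ∑ (vectors d) λ y → 𝟙 (B y) * 𝟙 (does (⟨ a , y ⟩ Fin.≟ t))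

    S≤∑fibres : ∀ a → S ≤ ∑ (allFin p) (fibre a)
    S≤∑fibres a = begin
      ∑ (vectors d) (λ y → 𝟙 (B y))
        ≡⟨ ∑-cong (vectors d) (λ y → *-identityʳ (𝟙 (B y))) ⟨
      ∑ (vectors d) (λ y → 𝟙 (B y) * 1)
        ≤⟨ ∑-mono (vectors d) (λ y → *-monoʳ-≤ (𝟙 (B y)) (hit y)) ⟩
      ∑ (vectors d) (λ y → 𝟙 (B y) * ∑ (allFin p) (λ t → 𝟙 (does (⟨ a , y ⟩ Fin.≟ t))))
        ≡⟨ ∑-cong (vectors d) (λ y → *-distribˡ-∑ (allFin p) (𝟙 (B y)) _) ⟨
      ∑ (vectors d) (λ y → ∑ (allFin p) (λ t → 𝟙 (B y) * 𝟙 (does (⟨ a , y ⟩ Fin.≟ t))))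
        ≡⟨ ∑-comm (vectors d) (allFin p) _ ⟩
      ∑ (allFin p) (fibre a) ∎
      where
      open ≤-Reasoning
      hit : ∀ y → 1 ≤ ∑ (allFin p) (λ t → 𝟙 (does (⟨ a , y ⟩ Fin.≟ t)))
      hit y = ≤-trans (≤-reflexive (cong 𝟙 (sym (true-does (⟨ a , y ⟩ Fin.≟ ⟨ a , y ⟩) refl))))
        (member≤∑ (λ t → 𝟙 (does (⟨ a , y ⟩ Fin.≟ t))) (∈-allFin ⟨ a , y ⟩))

    ∑fibres²≤collisions : ∀ a → ∑ (allFin p) (λ t → fibre a t * fibre a t) ≤ collisions a
    ∑fibres²≤collisions a = begin
      ∑ ts (λ t → fibre a t * fibre a t)
        ≡⟨ (∑-cong ts λ t → trans (sym (*-distribʳ-∑ Vs (fibre a t) _)) (∑-cong Vs λ y → sym (*-distribˡ-∑ Vs (𝟙 (B y) * on y t) _))) ⟩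
      ∑ ts (λ t → ∑ Vs λ y → ∑ Vs λ y′ → 𝟙 (B y) * on y t * (𝟙 (B y′) * on y′ t))
        ≡⟨ trans (∑-comm ts Vs _) (∑-cong Vs λ y → ∑-comm ts Vs _) ⟩
      ∑ Vs (λ y → ∑ Vs λ y′ → ∑ ts λ t → 𝟙 (B y) * on y t * (𝟙 (B y′) * on y′ t))
        ≡⟨ (∑-cong Vs λ y → ∑-cong Vs λ y′ → trans (∑-cong ts λ t → regroup (𝟙 (B y)) (on y t) (𝟙 (B y′)) (on y′ t))
             (*-distribˡ-∑ ts (𝟙 (B y) * 𝟙 (B y′)) _)) ⟩
      ∑ Vs (λ y → ∑ Vs λ y′ → 𝟙 (B y) * 𝟙 (B y′) * ∑ ts λ t → on y t * on y′ t)
        ≤⟨ (∑-mono Vs λ y → ∑-mono Vs λ y′ → ≤-trans (*-monoʳ-≤ (𝟙 (B y) * 𝟙 (B y′)) (meet ⟨ a , y ⟩ ⟨ a , y′ ⟩)) (≤-reflexive (*-assoc (𝟙 (B y)) _ _))) ⟩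
      collisions a ∎
      where
      open ≤-Reasoning
      Vs = vectors d
      ts = allFin p
      on : V d → Fin p → ℕ
      on y t = 𝟙 (does (⟨ a , y ⟩ Fin.≟ t))
      regroup : ∀ a b c e → a * b * (c * e) ≡ a * c * (b * e)
      regroup = solve-∀
      meet : ∀ u v → ∑ ts (λ t → 𝟙 (does (u Fin.≟ t)) * 𝟙 (does (v Fin.≟ t))) ≤ 𝟙 (does (u Fin.≟ v))
      meet u v with u Fin.≟ v
      ... | yes refl = ≤-trans (∑-mono ts λ t → 𝟙*m≤m (does (u Fin.≟ t)) _)
        (∑𝟙≤1 ts _ (Unique.allFin⁺ p) λ t t′ et et′ → trans (sym (does-true (u Fin.≟ t) et)) (does-true (u Fin.≟ t′) et′))
      ... | no u≢v = ≤-trans (∑-mono ts λ t → apart t) (≤-reflexive (trans (∑-const ts 0) (*-zeroʳ (length ts))))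
        where
        apart : ∀ t → 𝟙 (does (u Fin.≟ t)) * 𝟙 (does (v Fin.≟ t)) ≤ 0
        apart t with u Fin.≟ t | v Fin.≟ t
        ... | yes refl | yes refl = contradiction refl u≢v
        ... | yes _    | no _     = z≤n
        ... | no _     | _        = z≤n

    -- An even distribution would put S/p vectors in the fibre above 0; the bad a have at most half
    -- of that.
    bad? : (a : V d) → Dec (2 * p * zeros B a ≤ S)
    bad? a = 2 * p * zeros B a ≤? S

    bad : V d → ℕ
    bad a = 𝟙 (does (bad? a))

    -- Cauchy–Schwarz over all p fibres, respectively over the p − 1 fibres other than the
    -- sparse fibre above 0.
    collisions-lower : ∀ a (b : Dec (2 * p * zeros B a ≤ S)) →
      4 * p * p′ * (S * S) + 𝟙 (does b) * (S * S) ≤ 4 * (p * p) * p′ * collisions a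
    collisions-lower a (no _) = begin
      4 * p * p′ * (S * S) + 0      ≡⟨ +-identityʳ _ ⟩
      4 * p * p′ * (S * S)          ≤⟨ *-monoʳ-≤ (4 * p * p′) (≤-trans (*-mono-≤ (S≤∑fibres a) (S≤∑fibres a)) (cauchy-schwarz (allFin p) (fibre a))) ⟩
      4 * p * p′ * (length (allFin p) * ∑ (allFin p) (λ t → fibre a t * fibre a t))
        ≤⟨ *-monoʳ-≤ (4 * p * p′) (*-mono-≤ (≤-reflexive (length-tabulate {n = p} (λ i → i))) (∑fibres²≤collisions a)) ⟩
      4 * p * p′ * (p * collisions a) ≡⟨ assoc p p′ (collisions a) ⟩
      4 * (p * p) * p′ * collisions a ∎
      where
      open ≤-Reasoning
      assoc : ∀ p q c → 4 * p * q * (p * c) ≡ 4 * (p * p) * q * c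
      assoc = solve-∀
    collisions-lower a (yes sparse) = begin
      4 * p * p′ * (S * S) + 1 * (S * S)             ≡⟨ square p′ S ⟩
      (suc (2 * p′) * S) * (suc (2 * p′) * S)        ≤⟨ *-mono-≤ most most ⟩
      (2 * p * T) * (2 * p * T)                      ≡⟨ regroup p T ⟩
      4 * (p * p) * (T * T)                          ≤⟨ *-monoʳ-≤ (4 * (p * p)) (cauchy-schwarz (tabulate suc) (fibre a)) ⟩
      4 * (p * p) * (length (tabulate {n = p′} Fin.suc) * ∑ (tabulate suc) (λ t → fibre a t * fibre a t))
        ≤⟨ *-monoʳ-≤ (4 * (p * p)) (*-mono-≤ (≤-reflexive (length-tabulate {n = p′} Fin.suc)) (≤-trans (m≤n+m _ (fibre a zero * fibre a zero)) (∑fibres²≤collisions a))) ⟩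
      4 * (p * p) * (p′ * collisions a)              ≡⟨ *-assoc (4 * (p * p)) p′ _ ⟨
      4 * (p * p) * p′ * collisions a                ∎
      where
      open ≤-Reasoning
      T = ∑ (tabulate {n = p′} Fin.suc) (fibre a)
      square : ∀ q s → 4 * (1 + q) * q * (s * s) + 1 * (s * s) ≡ ((1 + 2 * q) * s) * ((1 + 2 * q) * s)
      square = solve-∀
      regroup : ∀ p t → (2 * p * t) * (2 * p * t) ≡ 4 * (p * p) * (t * t)
      regroup = solve-∀
      split : ∀ q s → s + (1 + 2 * q) * s ≡ 2 * (1 + q) * s
      split = solve-∀
      most : suc (2 * p′) * S ≤ 2 * p * T
      most = +-cancelˡ-≤ S _ _ (begin
        S + suc (2 * p′) * S                        ≡⟨ split p′ S ⟩
        2 * p * S                                   ≤⟨ *-monoʳ-≤ (2 * p) (S≤∑fibres a) ⟩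
        2 * p * (fibre a zero + T)                  ≡⟨ *-distribˡ-+ (2 * p) (fibre a zero) T ⟩
        2 * p * fibre a zero + 2 * p * T            ≤⟨ +-monoˡ-≤ (2 * p * T) sparse ⟩
        S + 2 * p * T                               ∎)

    -- As (2p - 1)² = 4p(p - 1) + 1, a bad a has at least S²/(4p²(p - 1)) collisions more than S²/p.
    -- By `total-collisions` the excess over all a is at most S p^d; the main terms cancel because p
    -- · p^D = p^d.
    bad-count : ∑ (vectors d) bad * S ≤ 4 * (p * p * p) * p ^ d
    bad-count with S ≟ 0
    ... | yes S≡0 = ≤-trans (≤-reflexive (trans (cong (∑ (vectors d) bad *_) S≡0) (*-zeroʳ (∑ (vectors d) bad)))) z≤n
    ... | no S≢0 = *-cancelʳ-≤ _ _ S {{≢-nonZero S≢0}} (+-cancelˡ-≤ (p ^ d * (4 * p * p′ * (S * S))) _ _ (begin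
      p ^ d * (4 * p * p′ * (S * S)) + b * S * S
        ≡⟨ cong (λ z → p ^ d * (4 * p * p′ * (S * S)) + z) (*-assoc b S S) ⟩
      p ^ d * (4 * p * p′ * (S * S)) + b * (S * S)
        ≡⟨ cong₂ _+_ (∑-vectors-const d _) (*-distribʳ-∑ (vectors d) (S * S) bad) ⟨
      ∑ (vectors d) (λ _ → 4 * p * p′ * (S * S)) + ∑ (vectors d) (λ a → bad a * (S * S))
        ≡⟨ ∑-distrib-+ (vectors d) _ _ ⟨
      ∑ (vectors d) (λ a → 4 * p * p′ * (S * S) + bad a * (S * S))
        ≤⟨ ∑-mono (vectors d) (λ a → collisions-lower a (bad? a)) ⟩
      ∑ (vectors d) (λ a → 4 * (p * p) * p′ * collisions a)
        ≡⟨ *-distribˡ-∑ (vectors d) (4 * (p * p) * p′) collisions ⟩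
      4 * (p * p) * p′ * ∑ (vectors d) collisions
        ≤⟨ *-monoʳ-≤ (4 * (p * p) * p′) total-collisions ⟩
      4 * (p * p) * p′ * (S * S * p ^ D + S * (p * p ^ D))
        ≡⟨ expand p p′ S (p ^ D) ⟩
      p * p ^ D * (4 * p * p′ * (S * S)) + 4 * (p * p * p′) * (p * p ^ D) * S
        ≤⟨ +-monoʳ-≤ (p ^ d * (4 * p * p′ * (S * S))) (*-monoˡ-≤ S (*-monoˡ-≤ (p ^ d) (*-monoʳ-≤ 4 (*-monoʳ-≤ (p * p) (n≤1+n p′))))) ⟩
      p ^ d * (4 * p * p′ * (S * S)) + 4 * (p * p * p) * p ^ d * S ∎))
      where
      open ≤-Reasoning
      b = ∑ (vectors d) bad
      expand : ∀ p q s r → 4 * (p * p) * q * (s * s * r + s * (p * r)) ≡ p * r * (4 * p * q * (s * s)) + 4 * (p * p * q) * (p * r) * s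
      expand = solve-∀

  -- A potential that pays for the choices of each step

  module Potential (e : ℕ) (p≤2^e : p ≤ 2 ^ e) (1≤e : 1 ≤ e) where

    -- Chosen so that (1 - 1/(2p))^θ ≤ p^(-d): blocks of 2p - 1 factors halve, and e · d halvings
    -- outweigh p^d ≤ 2^(ed).
    θ : ℕ
    θ = suc (2 * p′) * (e * d)

    -- Of the factor 5p³, the bad a account for 4p³ by `bad-count` and the good ones for at most p³.
    C : ℕ
    C = 5 * (p * p * p) * p ^ d

    φ : (V d → Bool) → ℕ
    φ B = size B ^ θ

    1≤θ : 1 ≤ θ
    1≤θ = *-mono-≤ {1} {suc (2 * p′)} (s≤s z≤n) (*-mono-≤ {1} {e} {1} {d} 1≤e (s≤s z≤n))

    shrink : p ^ d * suc (2 * p′) ^ θ ≤ (2 * p) ^ θ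
    shrink = begin
      p ^ d * m ^ (m * (e * d))              ≤⟨ *-monoˡ-≤ (m ^ θ) (^-monoˡ-≤ d p≤2^e) ⟩
      (2 ^ e) ^ d * m ^ (m * (e * d))        ≡⟨ cong₂ _*_ (^-*-assoc 2 e d) (sym (^-*-assoc m m (e * d))) ⟩
      2 ^ (e * d) * (m ^ m) ^ (e * d)        ≡⟨ ^-distribʳ-* (e * d) 2 (m ^ m) ⟨
      (2 * m ^ m) ^ (e * d)                  ≤⟨ ^-monoˡ-≤ (e * d) ([1+m]^m≥2m^m m) ⟩
      (suc m ^ m) ^ (e * d)                  ≡⟨ ^-*-assoc (suc m) m (e * d) ⟩
      suc m ^ θ                              ≡⟨ cong (_^ θ) (eq p′) ⟩
      (2 * p) ^ θ                            ∎
      where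
      open ≤-Reasoning
      m = suc (2 * p′)
      eq : ∀ q → 2 + 2 * q ≡ 2 * (1 + q)
      eq = solve-∀

    size-restrict≤ : ∀ B a → size (restrict B a) ≤ size B
    size-restrict≤ B a = subst (size (restrict B a) ≤_) (size-restrict B a) (m≤m+n _ _)

    good-shrinks : ∀ B a → ¬ (2 * p * zeros B a ≤ S B) → p ^ d * φ (restrict B a) ≤ φ B
    good-shrinks B a good = *-cancelˡ-≤ ((2 * p) ^ θ) {{m^n≢0 (2 * p) θ}} (begin
      (2 * p) ^ θ * (p ^ d * R ^ θ)            ≡⟨ swap ((2 * p) ^ θ) (p ^ d) (R ^ θ) ⟩
      p ^ d * ((2 * p) ^ θ * R ^ θ)            ≡⟨ cong (p ^ d *_) (^-distribʳ-* θ (2 * p) R) ⟨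
      p ^ d * (2 * p * R) ^ θ                  ≤⟨ *-monoʳ-≤ (p ^ d) (^-monoˡ-≤ θ smaller) ⟩
      p ^ d * (suc (2 * p′) * S B) ^ θ         ≡⟨ cong (p ^ d *_) (^-distribʳ-* θ (suc (2 * p′)) (S B)) ⟩
      p ^ d * (suc (2 * p′) ^ θ * S B ^ θ)     ≡⟨ *-assoc (p ^ d) _ _ ⟨
      p ^ d * suc (2 * p′) ^ θ * S B ^ θ       ≤⟨ *-monoˡ-≤ (S B ^ θ) shrink ⟩
      (2 * p) ^ θ * S B ^ θ                    ∎)
      where
      open ≤-Reasoning
      R = size (restrict B a)
      swap : ∀ a b x → a * (b * x) ≡ b * (a * x)
      swap = solve-∀
      split : ∀ q s → 2 * (1 + q) * s ≡ s + (1 + 2 * q) * s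
      split = solve-∀
      smaller : 2 * p * R ≤ suc (2 * p′) * S B
      smaller = +-cancelˡ-≤ (S B) _ _ (begin
        S B + 2 * p * R                     ≤⟨ +-monoˡ-≤ (2 * p * R) (<⇒≤ (≰⇒> good)) ⟩
        2 * p * zeros B a + 2 * p * R       ≡⟨ *-distribˡ-+ (2 * p) (zeros B a) R ⟨
        2 * p * (zeros B a + R)             ≡⟨ cong (2 * p *_) (trans (+-comm (zeros B a) R) (size-restrict B a)) ⟩
        2 * p * S B                         ≡⟨ split p′ (S B) ⟩
        S B + suc (2 * p′) * S B            ∎)

    -- For a bad a the potential does not grow, and bad a are few when B is large. A good a divides
    -- it by at least p^d, so all good a together contribute at most S φ(B) with S ≤ p^d. Both sides
    -- carry a factor p^d to avoid this division.
    restrict-potential : ∀ B → ∑ (vectors d) (λ a → S B * φ (restrict B a)) ≤ C * φ B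
    restrict-potential B = *-cancelˡ-≤ (p ^ d) {{m^n≢0 p d}} (begin
      p ^ d * ∑ (vectors d) (λ a → s * φ (restrict B a))
        ≡⟨ *-distribˡ-∑ (vectors d) (p ^ d) _ ⟨
      ∑ (vectors d) (λ a → p ^ d * (s * φ (restrict B a)))
        ≤⟨ ∑-mono (vectors d) (λ a → pointwise a (bad? B a)) ⟩
      ∑ (vectors d) (λ a → bad B a * (p ^ d * s * φ B) + s * φ B)
        ≡⟨ trans (∑-distrib-+ (vectors d) _ _) (cong₂ _+_ (*-distribʳ-∑ (vectors d) _ (bad B)) (∑-vectors-const d _)) ⟩
      ∑ (vectors d) (bad B) * (p ^ d * s * φ B) + p ^ d * (s * φ B)
        ≡⟨ regroup (∑ (vectors d) (bad B)) (p ^ d) s (φ B) ⟩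
      p ^ d * ((∑ (vectors d) (bad B) * s + s) * φ B)
        ≤⟨ *-monoʳ-≤ (p ^ d) (*-monoˡ-≤ (φ B) (+-mono-≤ (bad-count B) s≤)) ⟩
      p ^ d * ((4 * (p * p * p) * p ^ d + p * p * p * p ^ d) * φ B)
        ≡⟨ cong (λ z → p ^ d * (z * φ B)) (collect (p * p * p) (p ^ d)) ⟩
      p ^ d * (C * φ B) ∎)
      where
      open ≤-Reasoning
      s = S B
      s≤ : s ≤ p * p * p * p ^ d
      s≤ = ≤-trans (size≤ B) (m≤n*m (p ^ d) (p * p * p))
      regroup : ∀ b r s f → b * (r * s * f) + r * (s * f) ≡ r * ((b * s + s) * f)
      regroup = solve-∀
      collect : ∀ c r → 4 * c * r + c * r ≡ 5 * c * r
      collect = solve-∀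
      swap : ∀ a b x → a * (b * x) ≡ b * (a * x)
      swap = solve-∀
      pointwise : ∀ a (b : Dec (2 * p * zeros B a ≤ s)) →
        p ^ d * (s * φ (restrict B a)) ≤ 𝟙 (does b) * (p ^ d * s * φ B) + s * φ B
      pointwise a (yes _) = begin
        p ^ d * (s * φ (restrict B a))                ≤⟨ *-monoʳ-≤ (p ^ d) (*-monoʳ-≤ s (^-monoˡ-≤ θ (size-restrict≤ B a))) ⟩
        p ^ d * (s * φ B)                             ≡⟨ trans (sym (*-assoc (p ^ d) s (φ B))) (sym (*-identityˡ (p ^ d * s * φ B))) ⟩
        1 * (p ^ d * s * φ B)                         ≤⟨ m≤m+n _ _ ⟩
        1 * (p ^ d * s * φ B) + s * φ B               ∎
      pointwise a (no good) = begin
        p ^ d * (s * φ (restrict B a))                ≡⟨ swap (p ^ d) s _ ⟩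
        s * (p ^ d * φ (restrict B a))                ≤⟨ *-monoʳ-≤ s (good-shrinks B a good) ⟩
        s * φ B                                       ∎

-- Cliques

-- `Q` will be orthogonality to the eliminated vector; elimination preserves the relation between
-- two pairs only if the y of the later one has this property.
allPairs-map : ∀ {A B : Set} {Q : A → Set} {R : A → A → Set} {R′ : B → B → Set} (f : A → B) →
  (∀ {v w} → Q w → R v w → R′ (f v) (f w)) → ∀ {xs} → All Q xs → AllPairs R xs → AllPairs R′ (map f xs)
allPairs-map f pres []       []       = []
allPairs-map f pres (_ ∷ qs) (r ∷ rs) =
  All.map⁺ (All.zipWith (λ (q , r) → pres q r) (qs , r)) ∷ allPairs-map f pres qs rs

module SkewSystems (p′ : ℕ) (prime-p : Prime (suc p′)) where
  open PrimeField p′ prime-p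

  _∙_ : ∀ {D} → (Fin D → ℤ) → (Fin D → ℤ) → ℤ
  a ∙ y = sum λ i → a i ℤ.* y i

  Pair : ℕ → Set
  Pair D = (Fin D → ℤ) × (Fin D → ℤ)

  Null : ∀ {D} → Pair D → Pair D → Set
  Null (a , _) (_ , y) = (+ p) ℤ.∣ (a ∙ y)

  ∣-sum : ∀ {D} (f : Fin D → ℤ) → (∀ i → (+ p) ℤ.∣ f i) → (+ p) ℤ.∣ sum f
  ∣-sum {zero}  f p∣f = ℤ.divides ℤ.0ℤ refl
  ∣-sum {suc D} f p∣f = ℤ.∣m∣n⇒∣m+n (p∣f zero) (∣-sum (f ∘ suc) (p∣f ∘ suc))

  pivot : ∀ {D} (a y : Fin D → ℤ) → ¬ (+ p) ℤ.∣ (a ∙ y) → ∃ λ r → ¬ (+ p) ℤ.∣ a r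
  pivot a y p∤ with Fin.any? (λ r → ¬? ((+ p) ℤ.∣? a r))
  ... | yes found = found
  ... | no none = contradiction (∣-sum _ λ i → ℤ.∣m⇒∣m*n (y i) (decidable-stable ((+ p) ℤ.∣? a i) λ p∤a → none (i , p∤a))) p∤

  -- Fraction-free elimination: aᵣ a′ - a′ᵣ a vanishes at r, so that coordinate can be deleted.
  -- Working over ℤ avoids inverses modulo p.
  eliminate : ∀ {D} (r : Fin (suc D)) (a : Fin (suc D) → ℤ) → Pair (suc D) → Pair D
  eliminate r a (a′ , y′) = (λ i → a r ℤ.* a′ (punchIn r i) ℤ.- a′ r ℤ.* a (punchIn r i)) , y′ ∘ punchIn r

  -- When p ∣ ⟨a, y′⟩, this says that elimination multiplies ⟨a′, y′⟩ by aᵣ modulo p, hence by a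
  -- unit if r is a pivot.
  eliminate-∙ : ∀ {D} (r : Fin (suc D)) (a a′ y′ : Fin (suc D) → ℤ) →
    proj₁ (eliminate r a (a′ , y′)) ∙ (y′ ∘ punchIn r) ℤ.+ a′ r ℤ.* (a ∙ y′) ≡ a r ℤ.* (a′ ∙ y′)
  eliminate-∙ r a a′ y′ = begin
    E ℤ.+ a′ r ℤ.* (a ∙ y′)
      ≡⟨ cong (ℤ._+_ E) (cong (a′ r ℤ.*_) (sum-remove {i = r} (λ i → a i ℤ.* y′ i))) ⟩
    E ℤ.+ a′ r ℤ.* (a r ℤ.* y′ r ℤ.+ Σ₀)
      ≡⟨ rearrange E (a′ r) (a r) (y′ r) Σ₀ ⟩
    a r ℤ.* (a′ r ℤ.* y′ r) ℤ.+ (E ℤ.+ a′ r ℤ.* Σ₀)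
      ≡⟨ cong (ℤ._+_ (a r ℤ.* (a′ r ℤ.* y′ r))) inner ⟩
    a r ℤ.* (a′ r ℤ.* y′ r) ℤ.+ a r ℤ.* Σ′
      ≡⟨ ℤ.*-distribˡ-+ (a r) (a′ r ℤ.* y′ r) Σ′ ⟨
    a r ℤ.* (a′ r ℤ.* y′ r ℤ.+ Σ′)
      ≡⟨ cong (a r ℤ.*_) (sum-remove {i = r} (λ i → a′ i ℤ.* y′ i)) ⟨
    a r ℤ.* (a′ ∙ y′) ∎
    where
    open ≡-Reasoning
    E = proj₁ (eliminate r a (a′ , y′)) ∙ (y′ ∘ punchIn r)
    Σ₀ = (a ∘ punchIn r) ∙ (y′ ∘ punchIn r)
    Σ′ = (a′ ∘ punchIn r) ∙ (y′ ∘ punchIn r)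
    rearrange : ∀ e u v z s → e ℤ.+ u ℤ.* (v ℤ.* z ℤ.+ s) ≡ v ℤ.* (u ℤ.* z) ℤ.+ (e ℤ.+ u ℤ.* s)
    rearrange = ℤ-Solver.solve-∀
    term : ∀ v u x z y → (v ℤ.* x ℤ.- u ℤ.* z) ℤ.* y ℤ.+ u ℤ.* (z ℤ.* y) ≡ v ℤ.* (x ℤ.* y)
    term = ℤ-Solver.solve-∀
    inner : E ℤ.+ a′ r ℤ.* Σ₀ ≡ a r ℤ.* Σ′
    inner = begin
      E ℤ.+ a′ r ℤ.* Σ₀
        ≡⟨ cong (ℤ._+_ E) (*-distribˡ-sum (a′ r) (λ i → a (punchIn r i) ℤ.* y′ (punchIn r i))) ⟩
      E ℤ.+ sum (λ i → a′ r ℤ.* (a (punchIn r i) ℤ.* y′ (punchIn r i)))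
        ≡⟨ sum-distrib-+ (λ i → (a r ℤ.* a′ (punchIn r i) ℤ.- a′ r ℤ.* a (punchIn r i)) ℤ.* y′ (punchIn r i)) (λ i → a′ r ℤ.* (a (punchIn r i) ℤ.* y′ (punchIn r i))) ⟨
      sum (λ i → (a r ℤ.* a′ (punchIn r i) ℤ.- a′ r ℤ.* a (punchIn r i)) ℤ.* y′ (punchIn r i) ℤ.+ a′ r ℤ.* (a (punchIn r i) ℤ.* y′ (punchIn r i)))
        ≡⟨ sum-cong-≗ (λ i → term (a r) (a′ r) (a′ (punchIn r i)) (a (punchIn r i)) (y′ (punchIn r i))) ⟩
      sum (λ i → a r ℤ.* (a′ (punchIn r i) ℤ.* y′ (punchIn r i)))
        ≡⟨ *-distribˡ-sum (a r) (λ i → a′ (punchIn r i) ℤ.* y′ (punchIn r i)) ⟨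
      a r ℤ.* Σ′ ∎

  -- A triangular matrix with nonzero diagonal has full rank. Each elimination uses up one pair and
  -- one coordinate; it keeps the system triangular because all later y are orthogonal to the
  -- removed a.
  skew-system-length : ∀ D (xs : List (Pair D)) → All (λ v → ¬ Null v v) xs → AllPairs Null xs → length xs ≤ D
  skew-system-length D       []              _        _          = z≤n
  skew-system-length zero    ((a , y) ∷ xs) (nn ∷ _) _          = contradiction (ℤ.divides ℤ.0ℤ refl) nn
  skew-system-length (suc D) ((a , y) ∷ xs) (nn ∷ nns) (ns ∷ nss) with pivot a y nn
  ... | r , p∤aᵣ = s≤s (subst (_≤ D) (length-map (eliminate r a) xs)
    (skew-system-length D (map (eliminate r a) xs)
      (All.map⁺ (All.zipWith (λ { {a′ , y′} (n , nn′) → nn′ ∘ reflects a′ y′ n }) (ns , nns)))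
      (allPairs-map {R = Null} {R′ = Null} (eliminate r a) (λ { {a′ , _} {_ , y′} n nl → preserves a′ y′ n nl }) ns nss)))
    where
    reflects : ∀ a′ y′ → (+ p) ℤ.∣ (a ∙ y′) → Null (eliminate r a (a′ , y′)) (eliminate r a (a′ , y′)) → (+ p) ℤ.∣ (a′ ∙ y′)
    reflects a′ y′ n nl = [ (λ p∣ → contradiction p∣ p∤aᵣ) , (λ p∣ → p∣) ]′
      (euclid-ℤ (a r) (a′ ∙ y′) (subst ((+ p) ℤ.∣_) (eliminate-∙ r a a′ y′) (ℤ.∣m∣n⇒∣m+n nl (ℤ.∣n⇒∣m*n (a′ r) n))))
    preserves : ∀ a′ y′ → (+ p) ℤ.∣ (a ∙ y′) → (+ p) ℤ.∣ (a′ ∙ y′) → (+ p) ℤ.∣ (proj₁ (eliminate r a (a′ , y′)) ∙ (y′ ∘ punchIn r))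
    preserves a′ y′ n nl = ℤ.∣m+n∣n⇒∣m (subst ((+ p) ℤ.∣_) (sym (eliminate-∙ r a a′ y′)) (ℤ.∣n⇒∣m*n (a r) nl)) (ℤ.∣n⇒∣m*n (a′ r) n)

-- The random graph

module OrderedGraph {U : Set} (E : U → U → Bool) where

  -- `E` is not symmetric: the order of the entries decides which endpoint supplies the first
  -- argument, and the graph only forgets it afterwards.
  adjacency : ∀ {n} → Vec U n → Fin n → Fin n → Bool
  adjacency (v ∷ ω) zero    zero    = false
  adjacency (v ∷ ω) zero    (suc j) = E v (lookup ω j)
  adjacency (v ∷ ω) (suc i) zero    = E v (lookup ω i)
  adjacency (v ∷ ω) (suc i) (suc j) = adjacency ω i j

  graph : ∀ {n} → Vec U n → Graph n
  graph ω = record { adj = adjacency ω ; symmetric = symm ω ; loopless = loop ω }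
    where
    symm : ∀ {n} (ω : Vec U n) i j → adjacency ω i j ≡ adjacency ω j i
    symm (v ∷ ω) zero    zero    = refl
    symm (v ∷ ω) zero    (suc j) = refl
    symm (v ∷ ω) (suc i) zero    = refl
    symm (v ∷ ω) (suc i) (suc j) = symm ω i j
    loop : ∀ {n} (ω : Vec U n) i → adjacency ω i i ≡ false
    loop (v ∷ ω) zero    = refl
    loop (v ∷ ω) (suc i) = loop ω i

  select : ∀ {n} → Subset n → Vec U n → List U
  select []            []      = []
  select (inside  ∷ T) (v ∷ ω) = v ∷ select T ω
  select (outside ∷ T) (v ∷ ω) = select T ω

  length-select : ∀ {n} (T : Subset n) (ω : Vec U n) → length (select T ω) ≡ ∣ T ∣
  length-select []            []      = refl
  length-select (inside  ∷ T) (v ∷ ω) = cong suc (length-select T ω)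
  length-select (outside ∷ T) (v ∷ ω) = length-select T ω

  all-select : ∀ {P : U → Set} {n} (T : Subset n) (ω : Vec U n) →
    (∀ i → i ∈ₛ T → P (lookup ω i)) → All P (select T ω)
  all-select []            []      h = []
  all-select (inside  ∷ T) (v ∷ ω) h = h zero here ∷ all-select T ω λ i i∈T → h (suc i) (there i∈T)
  all-select (outside ∷ T) (v ∷ ω) h = all-select T ω λ i i∈T → h (suc i) (there i∈T)

  homogeneous-select : ∀ {n b} (T : Subset n) (ω : Vec U n) → Homogeneous (adjacency ω) b T →
    AllPairs (λ v w → E v w ≡ b) (select T ω)
  homogeneous-select []            []      h = []
  homogeneous-select (inside ∷ T)  (v ∷ ω) h =
    all-select T ω (λ i i∈T → h zero (suc i) here (there i∈T) λ ()) ∷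
    homogeneous-select T ω λ i j i∈T j∈T i≢j → h (suc i) (suc j) (there i∈T) (there j∈T) (i≢j ∘ Fin.suc-injective)
  homogeneous-select (outside ∷ T) (v ∷ ω) h =
    homogeneous-select T ω λ i j i∈T j∈T i≢j → h (suc i) (suc j) (there i∈T) (there j∈T) (i≢j ∘ Fin.suc-injective)

module OrthogonalityGraph (p′ : ℕ) (prime-p : Prime (suc p′)) (D : ℕ) where
  open PrimeField p′ prime-p
  open Counting p′ prime-p D
  open SkewSystems p′ prime-p

  U : Set
  U = V d × V d

  E : U → U → Bool
  E (a , _) (_ , y) = orthogonal a y

  pairs : List U
  pairs = cartesianProductWith _,_ (vectors d) (vectors d)

  weight : U → ℕ
  weight v = 𝟙 (not (E v v))

  ok : (V d → Bool) → U → Bool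
  ok B (_ , y) = B y

  next : (V d → Bool) → U → V d → Bool
  next B (a , _) = restrict B a

  open OrderedGraph E
  open FirstMoment pairs weight ok next

  residue-0 : residue 0 ≡ zero
  residue-0 = Fin.toℕ-injective (toℕ-residue 0)

  orthogonal⇒∣ : ∀ {a y} → orthogonal a y ≡ true → (+ p) ℤ.∣ (+ dot a y)
  orthogonal⇒∣ {a} {y} o = subst ((+ p) ℤ.∣_) (ℤ.+-identityʳ (+ dot a y))
    (residue-∣ (dot a y) 0 (trans (does-true (⟨ a , y ⟩ Fin.≟ zero) o) (sym residue-0)))

  ∣⇒orthogonal : ∀ {a y} → (+ p) ℤ.∣ (+ dot a y) → orthogonal a y ≡ true
  ∣⇒orthogonal {a} {y} p∣ = true-does (⟨ a , y ⟩ Fin.≟ zero)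
    (Fin.toℕ-injective (trans (toℕ-residue (dot a y)) (n∣m⇒m%n≡0 (dot a y) p (ℤ.∣⇒∣ᵤ p∣))))

  coordinates : ∀ {D} → V D → Fin D → ℤ
  coordinates a i = + toℕ (lookup a i)

  coordinates-∙ : ∀ {D} (a y : V D) → coordinates a ∙ coordinates y ≡ + dot a y
  coordinates-∙ []      []      = refl
  coordinates-∙ (x ∷ a) (t ∷ y) = trans (cong₂ ℤ._+_ (sym (ℤ.pos-* (toℕ x) (toℕ t))) (coordinates-∙ a y))
    (sym (ℤ.pos-+ (toℕ x * toℕ t) (dot a y)))

  embed : U → Pair d
  embed (a , y) = coordinates a , coordinates y

  clique≤d : ∀ xs → All (λ v → ¬ weight v ≡ 0) xs → AllPairs (λ v w → E v w ≡ true) xs → length xs ≤ d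
  clique≤d xs ws es = subst (_≤ d) (length-map embed xs) (skew-system-length d (map embed xs)
    (All.map⁺ (All.map (λ {v} → nonnull v) ws))
    (AllPairs.map⁺ (AllPairs.map (λ { {a , _} {_ , y} o → subst ((+ p) ℤ.∣_) (sym (coordinates-∙ a y)) (orthogonal⇒∣ {a} {y} o) }) es)))
    where
    nonnull : ∀ v → ¬ weight v ≡ 0 → ¬ Null (embed v) (embed v)
    nonnull (a , y) w≢0 null = w≢0 (cong (𝟙 ∘ not) (∣⇒orthogonal {a} {y} (subst ((+ p) ℤ.∣_) (coordinates-∙ a y) null)))

  everything : V d → Bool
  everything _ = true

  -- Non-adjacency of the first chosen vertex to all later ones is exactly what keeps their y inside
  -- the restricted set, so the automaton never rejects along `T`.
  independent-accepted : ∀ {n} (T : Subset n) (ω : Vec U n) B → All (λ v → ok B v ≡ true) (select T ω) →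
    AllPairs (λ v w → E v w ≡ false) (select T ω) → 1 ≤ accepted ω ∣ T ∣ B
  independent-accepted []            []      B _          _          = ≤-refl
  independent-accepted (outside ∷ T) (v ∷ ω) B oks        is =
    skip ∣ T ∣ (independent-accepted T ω B oks is)
    where
    skip : ∀ k → 1 ≤ accepted ω k B → 1 ≤ accepted (v ∷ ω) k B
    skip zero    _  = ≤-refl
    skip (suc k) le = ≤-trans le (m≤m+n _ _)
  independent-accepted (inside ∷ T)  (v@(a , _) ∷ ω) B (o ∷ oks) (i ∷ is) =
    ≤-trans (≤-trans (independent-accepted T ω (restrict B a) oks′ is) (m≤m+n _ 0))
      (≤-trans (≤-reflexive (cong (λ b → 𝟙 b * accepted ω ∣ T ∣ (restrict B a)) (sym o))) (m≤n+m _ (accepted ω (suc ∣ T ∣) B)))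
    where
    oks′ : All (λ w → ok (restrict B a) w ≡ true) (select T ω)
    oks′ = All.zipWith (λ (o , i) → cong₂ (λ b c → b ∧ not c) o i) (oks , i)

  ∑-pairs : ∀ (f : U → ℕ) → ∑ pairs f ≡ ∑ (vectors d) λ a → ∑ (vectors d) λ y → f (a , y)
  ∑-pairs f = ∑-cartesianProductWith _,_ (vectors d) (vectors d) f

  zero-vector : V d
  zero-vector = replicate d zero

  dot-zeroʳ : ∀ {D} (a : V D) → dot a (replicate D zero) ≡ 0
  dot-zeroʳ []      = refl
  dot-zeroʳ {suc D} (x ∷ a) = trans (cong (_+ dot a (replicate D zero)) (*-zeroʳ (toℕ x))) (dot-zeroʳ a)

  -- Orthogonality to y is agreement of y with the zero vector, so `agree-count′` applies; the extra
  -- p ^ d is the case y = 0.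
  orthogonal-pairs : ∑ pairs (𝟙 ∘ (λ v → E v v)) ≤ p ^ d * p ^ D + p ^ d
  orthogonal-pairs = begin
    ∑ pairs (λ v → 𝟙 (E v v))
      ≡⟨ trans (∑-pairs _) (∑-comm Vs Vs _) ⟩
    ∑ Vs (λ y → ∑ Vs λ a → 𝟙 (orthogonal a y))
      ≡⟨ (∑-cong Vs λ y → ∑-cong Vs λ a → cong (λ z → 𝟙 (does (⟨ a , y ⟩ Fin.≟ z))) (sym (trans (cong residue (dot-zeroʳ a)) residue-0))) ⟩
    ∑ Vs (λ y → ∑ Vs λ a → 𝟙 (does (⟨ a , y ⟩ Fin.≟ ⟨ a , zero-vector ⟩)))
      ≤⟨ ∑-mono Vs (λ y → agree-count′ y zero-vector) ⟩
    ∑ Vs (λ y → p ^ D + 𝟙 (does (Vec.≡-dec Fin._≟_ y zero-vector)) * p ^ d)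
      ≡⟨ trans (∑-distrib-+ Vs _ _) (cong₂ _+_ (∑-vectors-const d (p ^ D)) (*-distribʳ-∑ Vs (p ^ d) _)) ⟩
    p ^ d * p ^ D + ∑ Vs (λ y → 𝟙 (does (Vec.≡-dec Fin._≟_ y zero-vector))) * p ^ d
      ≤⟨ +-monoʳ-≤ (p ^ d * p ^ D) (*-monoˡ-≤ (p ^ d) (∑𝟙≤1 Vs _ (vectors-unique d) λ u v eu ev →
           trans (does-true (Vec.≡-dec Fin._≟_ u zero-vector) eu) (sym (does-true (Vec.≡-dec Fin._≟_ v zero-vector) ev)))) ⟩
    p ^ d * p ^ D + 1 * p ^ d
      ≡⟨ cong (λ z → p ^ d * p ^ D + z) (*-identityˡ (p ^ d)) ⟩
    p ^ d * p ^ D + p ^ d ∎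
    where
    open ≤-Reasoning
    Vs = vectors d

  -- With q = p^d the orthogonal pairs number at most q²/p + q ≤ q²/2 + q²/4, where q ≥ 4 uses that
  -- the dimension is at least 2.
  W-lower : 1 ≤ D → p ^ d * p ^ d ≤ 4 * W
  W-lower 1≤D = +-cancelʳ-≤ (3 * (q * q)) (q * q) (4 * W) (begin
    q * q + 3 * (q * q)                 ≡⟨ four (q * q) ⟩
    4 * (q * q)                         ≡⟨ cong (4 *_) (trans (cong (q *_) (sym (*-identityʳ q))) everything-splits) ⟩
    4 * (W + Z)                         ≤⟨ *-monoʳ-≤ 4 (+-monoʳ-≤ W orthogonal-pairs) ⟩
    4 * (W + (q * q′ + q))               ≡⟨ expand W q q′ ⟩
    4 * W + (2 * (q * (2 * q′)) + 4 * q) ≤⟨ +-monoʳ-≤ (4 * W) (+-mono-≤ (*-monoʳ-≤ 2 (*-monoʳ-≤ q (*-monoˡ-≤ q′ 2≤p))) (*-monoˡ-≤ q 4≤q)) ⟩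
    4 * W + (2 * (q * q) + q * q)       ≡⟨ cong (λ z → 4 * W + z) (three (q * q)) ⟩
    4 * W + 3 * (q * q)                 ∎)
    where
    open ≤-Reasoning
    q = p ^ d
    q′ = p ^ D
    Z = ∑ pairs (𝟙 ∘ (λ v → E v v))
    2≤p : 2 ≤ p
    2≤p = prime⇒2≤ prime-p
    4≤q : 4 ≤ q
    4≤q = *-mono-≤ 2≤p (≤-trans 2≤p (≤-trans (≤-reflexive (sym (*-identityʳ p))) (^-monoʳ-≤ p 1≤D)))
    four : ∀ x → x + 3 * x ≡ 4 * x
    four = solve-∀
    three : ∀ x → 2 * x + x ≡ 3 * x
    three = solve-∀
    expand : ∀ w q r → 4 * (w + (q * r + q)) ≡ 4 * w + (2 * (q * (2 * r)) + 4 * q)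
    expand = solve-∀
    one : ∀ b → 𝟙 (not b) + 𝟙 b ≡ 1
    one true  = refl
    one false = refl
    everything-splits : q * (q * 1) ≡ W + Z
    everything-splits = begin-equality
      q * (q * 1)                                 ≡⟨ trans (∑-cong (vectors d) (λ _ → ∑-vectors-const d 1)) (∑-vectors-const d (q * 1)) ⟨
      ∑ (vectors d) (λ a → ∑ (vectors d) λ y → 1) ≡⟨ ∑-pairs (λ _ → 1) ⟨
      ∑ pairs (λ _ → 1)                           ≡⟨ ∑-cong pairs (λ v → one (E v v)) ⟨
      ∑ pairs (λ v → weight v + 𝟙 (E v v))        ≡⟨ ∑-distrib-+ pairs weight _ ⟩
      W + Z                                       ∎

  module _ (e : ℕ) (p≤2^e : p ≤ 2 ^ e) (1≤e : 1 ≤ e) where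
    open Potential e p≤2^e 1≤e

    step : ∀ B → ∑ pairs (λ v → weight v * (𝟙 (ok B v) * φ (next B v))) ≤ C * φ B
    step B = begin
      ∑ pairs (λ v → weight v * (𝟙 (ok B v) * φ (next B v)))
        ≤⟨ ∑-mono pairs (λ v → 𝟙*m≤m (not (E v v)) _) ⟩
      ∑ pairs (λ v → 𝟙 (ok B v) * φ (next B v))
        ≡⟨ ∑-pairs _ ⟩
      ∑ (vectors d) (λ a → ∑ (vectors d) λ y → 𝟙 (B y) * φ (restrict B a))
        ≡⟨ ∑-cong (vectors d) (λ a → *-distribʳ-∑ (vectors d) (φ (restrict B a)) _) ⟩
      ∑ (vectors d) (λ a → S B * φ (restrict B a))
        ≤⟨ restrict-potential B ⟩
      C * φ B ∎
      where open ≤-Reasoning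

    last-step : ∀ B → ∑ pairs (λ v → weight v * 𝟙 (ok B v)) ≤ C * φ B
    last-step B = begin
      ∑ pairs (λ v → weight v * 𝟙 (ok B v))      ≤⟨ ∑-mono pairs (λ v → 𝟙*m≤m (not (E v v)) _) ⟩
      ∑ pairs (λ v → 𝟙 (ok B v))                 ≡⟨ ∑-pairs _ ⟩
      ∑ (vectors d) (λ a → S B)                  ≡⟨ ∑-vectors-const d (S B) ⟩
      p ^ d * S B                                ≤⟨ *-mono-≤ (m≤n*m (p ^ d) (5 * (p * p * p))) (m≤m^n (S B) 1≤θ) ⟩
      C * φ B                                    ∎
      where open ≤-Reasoning

    ramsey⇒W^k≤ : ∀ n k → RamseyProperty (suc d) (suc k) n → W ^ suc k ≤ n ^ suc k * (C ^ suc k * φ everything)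
    ramsey⇒W^k≤ n k ramsey = ≮⇒≥ λ small →
      let ω , none , ws = ∃-none-accepted φ C last-step step n k everything small in
      [ (λ (T , clique , size-T) → <⇒≱ (≤-reflexive (sym (trans (length-select T ω) size-T)))
          (clique≤d (select T ω) (all-select T ω (λ i _ → VAll.lookup⁺ ws i)) (homogeneous-select T ω clique)))
      , (λ (T , indep , size-T) → <⇒≱ (subst (λ j → 1 ≤ accepted ω j everything) size-T
          (independent-accepted T ω everything (all-select T ω λ _ _ → refl) (homogeneous-select T ω indep))) (≤-reflexive none))
      ]′ (ramsey (graph ω))

    -- The 20 is the 4 of `W-lower` times the 5 of `C`, and `(p ^ d) ^ θ` is the potential of the
    -- initial state.
    ramsey-inequality : ∀ n k → 1 ≤ D → RamseyProperty (suc d) (suc k) n →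
      (p ^ d) ^ suc k ≤ (20 * (p * p * p) * n) ^ suc k * (p ^ d) ^ θ
    ramsey-inequality n k 1≤D ramsey = *-cancelˡ-≤ ((p ^ d) ^ suc k) {{m^n≢0 (p ^ d) (suc k) {{m^n≢0 p d}}}} (begin
      q ^ K * q ^ K                                       ≡⟨ ^-distribʳ-* K q q ⟨
      (q * q) ^ K                                         ≤⟨ ^-monoˡ-≤ K (W-lower 1≤D) ⟩
      (4 * W) ^ K                                         ≡⟨ ^-distribʳ-* K 4 W ⟩
      4 ^ K * W ^ K                                       ≤⟨ *-monoʳ-≤ (4 ^ K) (ramsey⇒W^k≤ n k ramsey) ⟩
      4 ^ K * (n ^ K * (C ^ K * φ everything))            ≡⟨ assoc (4 ^ K) (n ^ K) (C ^ K) _ ⟩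
      4 ^ K * n ^ K * C ^ K * φ everything                ≡⟨ cong (_* φ everything) (trans (cong (_* C ^ K) (sym (^-distribʳ-* K 4 n))) (sym (^-distribʳ-* K (4 * n) C))) ⟩
      (4 * n * C) ^ K * φ everything                      ≡⟨ cong (λ z → z ^ K * φ everything) (arrange n (p * p * p) q) ⟩
      (q * (20 * (p * p * p) * n)) ^ K * φ everything     ≡⟨ cong (_* φ everything) (^-distribʳ-* K q _) ⟩
      q ^ K * (20 * (p * p * p) * n) ^ K * φ everything   ≡⟨ *-assoc (q ^ K) _ _ ⟩
      q ^ K * ((20 * (p * p * p) * n) ^ K * φ everything)
        ≤⟨ *-monoʳ-≤ (q ^ K) (*-monoʳ-≤ ((20 * (p * p * p) * n) ^ K) (^-monoˡ-≤ θ (size≤ everything))) ⟩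
      q ^ K * ((20 * (p * p * p) * n) ^ K * q ^ θ)        ∎)
      where
      open ≤-Reasoning
      q = p ^ d
      K = suc k
      assoc : ∀ a b c x → a * (b * (c * x)) ≡ a * b * c * x
      assoc = solve-∀
      arrange : ∀ n c q → 4 * n * (5 * c * q) ≡ q * (20 * c * n)
      arrange = solve-∀

-- Choice of the parameters

^-cancelʳ-≤ : ∀ k .{{_ : NonZero k}} {m n} → m ^ k ≤ n ^ k → m ≤ n
^-cancelʳ-≤ k le = ≮⇒≥ λ n<m → <⇒≱ (^-monoˡ-< k n<m) le

1+n≤2^n : ∀ n → suc n ≤ 2 ^ n
1+n≤2^n zero    = ≤-refl
1+n≤2^n (suc n) = ≤-trans (+-mono-≤ (m^n>0 2 n) (1+n≤2^n n)) (≤-reflexive (cong (λ z → 2 ^ n + z) (sym (+-identityʳ (2 ^ n)))))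

m<[1+m/n]*n : ∀ m n .{{_ : NonZero n}} → m < suc (m ℕ./ n) * n
m<[1+m/n]*n m n = subst (_< suc (m ℕ./ n) * n) (sym (m≡m%n+[m/n]*n m n)) (+-monoˡ-< (m ℕ./ n * n) (m%n<n m n))

-- With w = ⌊v/(2j)⌋, half of the exponent 2jw ≤ v absorbs K (2j)^j ≤ w, and the other half absorbs
-- (w + 1)^j.
polynomial≤exponential : ∀ K j v .{{_ : NonZero j}} → K * (2 * j) ^ j * (2 * j) ≤ v → K * suc v ^ j ≤ 2 ^ v
polynomial≤exponential K j v v≥ = bound (v ℕ./ i) (m<[1+m/n]*n v i) (m/n*n≤m v i)
    (≮⇒≥ λ lt → <⇒≱ (m<[1+m/n]*n v i) (≤-trans (*-monoˡ-≤ i lt) v≥))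
  where
  open ≤-Reasoning
  i = 2 * j
  M = K * i ^ j
  instance
    _ : NonZero i
    _ = m*n≢0 2 j
  regroup : ∀ w j → w * j + w * j ≡ w * (2 * j)
  regroup = solve-∀
  bound : ∀ w → suc v ≤ suc w * i → w * i ≤ v → M ≤ w → K * suc v ^ j ≤ 2 ^ v
  bound w v< wi≤v M≤w = begin
    K * suc v ^ j                  ≤⟨ *-monoʳ-≤ K (^-monoˡ-≤ j v<) ⟩
    K * (suc w * i) ^ j            ≡⟨ cong (K *_) (trans (cong (_^ j) (*-comm (suc w) i)) (^-distribʳ-* j i (suc w))) ⟩
    K * (i ^ j * suc w ^ j)        ≡⟨ *-assoc K (i ^ j) (suc w ^ j) ⟨
    M * suc w ^ j                  ≤⟨ *-mono-≤ M≤ (^-monoˡ-≤ j (1+n≤2^n w)) ⟩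
    2 ^ (w * j) * (2 ^ w) ^ j      ≡⟨ cong (2 ^ (w * j) *_) (^-*-assoc 2 w j) ⟩
    2 ^ (w * j) * 2 ^ (w * j)      ≡⟨ ^-distribˡ-+-* 2 (w * j) (w * j) ⟨
    2 ^ (w * j + w * j)            ≡⟨ cong (2 ^_) (regroup w j) ⟩
    2 ^ (w * i)                    ≤⟨ ^-monoʳ-≤ 2 wi≤v ⟩
    2 ^ v                          ∎
    where
    M≤ : M ≤ 2 ^ (w * j)
    M≤ = ≤-trans M≤w (≤-trans (<⇒≤ (1+n≤2^n w)) (^-monoʳ-≤ 2 (m≤m*n w j)))

-- The upper bound on p makes u · θ at most k in the application. The last condition is p ≥ (h +
-- 1)^(1 - 1/u): replacing k/s by p costs only a small part of the exponent.
GoodPrime : ℕ → ℕ → ℕ → ℕ → Set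
GoodPrime u h p e = Prime p × 1 ≤ e × p ≤ 2 ^ e × 2 * u * e * p ≤ h × suc h ^ u ≤ suc h * p ^ u

-- With e ≈ log₂ h the prime lies between h/(8ue²) and h/(2ue).
prime-in-range : ∀ u e Q h .{{_ : NonZero u}} .{{_ : NonZero Q}} → Q ≡ 2 * u * e → 1 ≤ e →
  4 * Q ≤ h → (4 * Q * e) ^ u ≤ h → h ≤ 2 ^ e → ∃ λ p → GoodPrime u h p e
prime-in-range u e Q h Q≡ 1≤e 4Q≤h A^u≤h h≤2^e = select (prime-above N e 1≤N (≤-trans m≤h h≤2^e))
  where
  open ≤-Reasoning
  instance
    4Q≢0 : NonZero (4 * Q)
    4Q≢0 = m*n≢0 4 Q
  N = h ℕ./ (4 * Q)
  1≤N : 1 ≤ N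
  1≤N = ≮⇒≥ λ N<1 → <⇒≱ (m<[1+m/n]*n h (4 * Q))
    (≤-trans (≤-reflexive (trans (cong (λ z → suc z * (4 * Q)) (n<1⇒n≡0 N<1)) (*-identityˡ (4 * Q)))) 4Q≤h)
  Q*m≤h : Q * suc (N + N) ≤ h
  Q*m≤h = begin
    Q * (1 + (N + N))          ≤⟨ *-monoʳ-≤ Q (+-mono-≤ 1≤N (+-monoʳ-≤ N (m≤m+n N N))) ⟩
    Q * (N + (N + (N + N)))    ≡⟨ eq Q N ⟩
    N * (4 * Q)                ≤⟨ m/n*n≤m h (4 * Q) ⟩
    h                          ∎
    where
    eq : ∀ q n → q * (n + (n + (n + n))) ≡ n * (4 * q)
    eq = solve-∀
  m≤h : suc (N + N) ≤ h
  m≤h = ≤-trans (m≤n*m (suc (N + N)) Q) Q*m≤h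
  select : (∃ λ p → Prime p × p ≤ suc (N + N) × N + N ≤ e * p) → ∃ λ p → GoodPrime u h p e
  select (p , pr , p≤m , N+N≤) = p , pr , 1≤e , ≤-trans p≤m (≤-trans m≤h h≤2^e) ,
    subst (λ q → q * p ≤ h) Q≡ (≤-trans (*-monoʳ-≤ Q p≤m) Q*m≤h) , (begin
      suc h ^ u                       ≤⟨ ^-monoˡ-≤ u y≤ ⟩
      (4 * Q * e * p) ^ u             ≡⟨ ^-distribʳ-* u (4 * Q * e) p ⟩
      (4 * Q * e) ^ u * p ^ u         ≤⟨ *-monoˡ-≤ (p ^ u) (≤-trans A^u≤h (n≤1+n h)) ⟩
      suc h * p ^ u                   ∎)
    where
    y≤ : suc h ≤ 4 * Q * e * p
    y≤ = begin
      suc h                        ≤⟨ m<[1+m/n]*n h (4 * Q) ⟩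
      (1 + N) * (4 * Q)            ≤⟨ *-monoˡ-≤ (4 * Q) (+-monoˡ-≤ N 1≤N) ⟩
      (N + N) * (4 * Q)            ≡⟨ *-comm (N + N) (4 * Q) ⟩
      4 * Q * (N + N)              ≤⟨ *-monoʳ-≤ (4 * Q) N+N≤ ⟩
      4 * Q * (e * p)              ≡⟨ *-assoc (4 * Q) e p ⟨
      4 * Q * e * p                ∎

-- For v = ⌊log₂ h⌋ and e = v + 1, the ratio of h to p is at most about 8ue²; its u-th power is
-- polynomial in v and so stays below 2^v ≤ h.
good-prime : ∀ u v₀ h .{{_ : NonZero u}} → (∀ v → v₀ ≤ v → (8 * u) ^ u * suc v ^ (2 * u) ≤ 2 ^ v) →
  2 ^ v₀ ≤ h → ∃₂ (GoodPrime u h)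
good-prime u v₀ h poly H≤h = at (largest-power≤ 2 ≤-refl h (≤-trans (m^n>0 2 v₀) H≤h))
  where
  open ≤-Reasoning
  eq : ∀ u e → 4 * (2 * u * e) * e ≡ 8 * u * (e * (e * 1))
  eq = solve-∀
  A^u≤2^v : ∀ v e → e ≡ suc v → v₀ ≤ v → (4 * (2 * u * e) * e) ^ u ≤ 2 ^ v
  A^u≤2^v v e refl v₀≤v = begin
    (4 * (2 * u * e) * e) ^ u      ≡⟨ cong (_^ u) (eq u e) ⟩
    (8 * u * e ^ 2) ^ u            ≡⟨ ^-distribʳ-* u (8 * u) (e ^ 2) ⟩
    (8 * u) ^ u * (e ^ 2) ^ u      ≡⟨ cong ((8 * u) ^ u *_) (^-*-assoc e 2 u) ⟩
    (8 * u) ^ u * e ^ (2 * u)      ≤⟨ poly v v₀≤v ⟩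
    2 ^ v                          ∎
  at : (∃ λ v → 2 ^ v ≤ h × h < 2 ^ suc v) → ∃₂ (GoodPrime u h)
  at (v , lo , hi) = proj₁ found , suc v , proj₂ found
    where
    instance
      Q≢0 : NonZero (2 * u * suc v)
      Q≢0 = m*n≢0 (2 * u) (suc v) {{m*n≢0 2 u}}
    A^u≤h : (4 * (2 * u * suc v) * suc v) ^ u ≤ h
    A^u≤h = ≤-trans (A^u≤2^v v (suc v) refl (s≤s⁻¹ (≰⇒> λ v<v₀ → <⇒≱ hi (≤-trans (^-monoʳ-≤ 2 v<v₀) H≤h)))) lo
    4Q≤h : 4 * (2 * u * suc v) ≤ h
    4Q≤h = ≤-trans (m≤m*n (4 * (2 * u * suc v)) (suc v))
      (≤-trans (m≤m^n (4 * (2 * u * suc v) * suc v) (>-nonZero⁻¹ u)) A^u≤h)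
    found : ∃ λ p → GoodPrime u h p (suc v)
    found = prime-in-range u (suc v) (2 * u * suc v) h refl (s≤s z≤n) 4Q≤h A^u≤h (<⇒≤ hi)

-- Bookkeeping of the exponents

cancel-powers : ∀ X Y u θ K .{{_ : NonZero X}} .{{_ : NonZero K}} →
  θ * suc u ≤ K → X ^ K ≤ Y ^ K * X ^ θ → X ^ u ≤ Y ^ suc u
cancel-powers X Y u θ K θu≤K key = *-cancelˡ-≤ X (^-cancelʳ-≤ K (begin
  (X ^ suc u) ^ K                   ≡⟨ swap X ⟩
  (X ^ K) ^ suc u                   ≤⟨ ^-monoˡ-≤ (suc u) key ⟩
  (Y ^ K * X ^ θ) ^ suc u           ≡⟨ ^-distribʳ-* (suc u) (Y ^ K) (X ^ θ) ⟩
  (Y ^ K) ^ suc u * (X ^ θ) ^ suc u ≡⟨ cong₂ _*_ (sym (swap Y)) (^-*-assoc X θ (suc u)) ⟩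
  (Y ^ suc u) ^ K * X ^ (θ * suc u) ≤⟨ *-monoʳ-≤ ((Y ^ suc u) ^ K) (^-monoʳ-≤ X θu≤K) ⟩
  (Y ^ suc u) ^ K * X ^ K           ≡⟨ *-comm ((Y ^ suc u) ^ K) (X ^ K) ⟩
  X ^ K * (Y ^ suc u) ^ K           ≡⟨ ^-distribʳ-* K X (Y ^ suc u) ⟨
  (X * Y ^ suc u) ^ K               ∎))
  where
  open ≤-Reasoning
  swap : ∀ Z → (Z ^ suc u) ^ K ≡ (Z ^ K) ^ suc u
  swap Z = trans (^-*-assoc Z (suc u) K) (trans (cong (Z ^_) (*-comm (suc u) K)) (sym (^-*-assoc Z K (suc u))))

absorb-constant : ∀ p n d u m → 2 ≤ p → 8 * suc u + m ≤ d * u →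
  (p ^ d) ^ u ≤ (20 * (p * p * p) * n) ^ suc u → p ^ m ≤ n ^ suc u
absorb-constant p n d u m 2≤p exponents le = *-cancelˡ-≤ (p ^ (8 * suc u)) {{m^n≢0 p (8 * suc u)}} (begin
  p ^ (8 * suc u) * p ^ m              ≡⟨ ^-distribˡ-+-* p (8 * suc u) m ⟨
  p ^ (8 * suc u + m)                  ≤⟨ ^-monoʳ-≤ p exponents ⟩
  p ^ (d * u)                          ≡⟨ ^-*-assoc p d u ⟨
  (p ^ d) ^ u                          ≤⟨ le ⟩
  (20 * (p * p * p) * n) ^ suc u       ≤⟨ ^-monoˡ-≤ (suc u) (*-monoˡ-≤ n constant) ⟩
  (p ^ 8 * n) ^ suc u                  ≡⟨ ^-distribʳ-* (suc u) (p ^ 8) n ⟩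
  (p ^ 8) ^ suc u * n ^ suc u          ≡⟨ cong (_* n ^ suc u) (^-*-assoc p 8 (suc u)) ⟩
  p ^ (8 * suc u) * n ^ suc u          ∎)
  where
  open ≤-Reasoning
  instance
    p≢0 : NonZero p
    p≢0 = >-nonZero (<⇒≤ 2≤p)
  cube : ∀ p → p * p * p ≡ p * (p * (p * 1))
  cube = solve-∀
  constant : 20 * (p * p * p) ≤ p ^ 8
  constant = begin
    20 * (p * p * p)          ≤⟨ *-monoˡ-≤ (p * p * p) (≤-trans (m≤m+n 20 12) (^-monoˡ-≤ 5 2≤p)) ⟩
    p ^ 5 * (p * p * p)       ≡⟨ cong (p ^ 5 *_) (cube p) ⟩
    p ^ 5 * p ^ 3             ≡⟨ ^-distribˡ-+-* p 5 3 ⟨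
    p ^ 8                     ∎

-- The permitted loss 1/(c + 1) is split into thirds: one for passing from h to p, one for θ, one
-- for the factor 20p³ and the missing dimension. It suffices that (3c + 2)(3c + 1) = 9c(c + 1) + 2.
combine-exponents : ∀ c s y p n u → suc u ≡ 3 * suc c → y ^ u ≤ p ^ suc u → p ^ ((1 + 3 * c) * s) ≤ n ^ suc u →
  .{{_ : NonZero y}} → y ^ (c * s) ≤ n ^ suc c
combine-exponents c s y p n u u≡ y^u≤ p^m≤ = ^-cancelʳ-≤ (9 * suc c) (begin
  (y ^ (c * s)) ^ (9 * suc c)            ≡⟨ ^-*-assoc y (c * s) (9 * suc c) ⟩
  y ^ (c * s * (9 * suc c))              ≤⟨ ^-monoʳ-≤ y (≤-trans (m≤m+n (c * s * (9 * suc c)) (2 * s)) (≤-reflexive (trans (eq₁ c s) (cong (_* m) (sym u≡′))))) ⟩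
  y ^ (u * m)                            ≡⟨ ^-*-assoc y u m ⟨
  (y ^ u) ^ m                            ≤⟨ ^-monoˡ-≤ m y^u≤ ⟩
  (p ^ suc u) ^ m                        ≡⟨ trans (^-*-assoc p (suc u) m) (trans (cong (p ^_) (*-comm (suc u) m)) (sym (^-*-assoc p m (suc u)))) ⟩
  (p ^ m) ^ suc u                        ≤⟨ ^-monoˡ-≤ (suc u) p^m≤ ⟩
  (n ^ suc u) ^ suc u                    ≡⟨ ^-*-assoc n (suc u) (suc u) ⟩
  n ^ (suc u * suc u)                    ≡⟨ cong (n ^_) (trans (cong₂ _*_ u≡ u≡) (eq₂ c)) ⟩
  n ^ (suc c * (9 * suc c))              ≡⟨ ^-*-assoc n (suc c) (9 * suc c) ⟨
  (n ^ suc c) ^ (9 * suc c)              ∎)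
  where
  open ≤-Reasoning
  m = (1 + 3 * c) * s
  eq₀ : ∀ c → 3 * (1 + c) ≡ 1 + (2 + 3 * c)
  eq₀ = solve-∀
  eq₁ : ∀ c s → c * s * (9 * (1 + c)) + 2 * s ≡ (2 + 3 * c) * ((1 + 3 * c) * s)
  eq₁ = solve-∀
  eq₂ : ∀ c → (3 * (1 + c)) * (3 * (1 + c)) ≡ (1 + c) * (9 * (1 + c))
  eq₂ = solve-∀
  u≡′ : u ≡ 2 + 3 * c
  u≡′ = suc-injective (trans u≡ (eq₀ c))

ramsey-from-prime : ∀ c u D h k n → suc u ≡ 3 * suc c → 24 + 27 * c ≤ D → h * (2 + D) ≤ suc k →
  RamseyProperty (2 + D) (suc k) n → (∃₂ λ p e → GoodPrime (suc u) h p e) → suc h ^ (c * (2 + D)) ≤ n ^ suc c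
ramsey-from-prime c u D h k n u≡ D≥ hs≤k ramsey (zero , _ , pr , _) = contradiction pr ¬prime[0]
ramsey-from-prime c u D h k n u≡ D≥ hs≤k ramsey (p@(suc p′) , e , pr , 1≤e , p≤2^e , small , large) =
  combine-exponents c (2 + D) (suc h) p n u u≡ (*-cancelˡ-≤ (suc h) large)
    (absorb-constant p n (suc D) u ((1 + 3 * c) * (2 + D)) (prime⇒2≤ pr) exponents
      (cancel-powers (p ^ suc D) (20 * (p * p * p) * n) u (suc (2 * p′) * (e * suc D)) (suc k) {{m^n≢0 p (suc D)}} θu≤K
        (OrthogonalityGraph.ramsey-inequality p′ pr D e p≤2^e 1≤e n k (≤-trans (s≤s z≤n) D≥) ramsey)))
  where
  open ≤-Reasoning
  θu≤K : suc (2 * p′) * (e * suc D) * suc u ≤ suc k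
  θu≤K = begin
    suc (2 * p′) * (e * suc D) * suc u    ≤⟨ *-monoˡ-≤ (suc u) (*-monoˡ-≤ (e * suc D) (≤-trans (n≤1+n _) (≤-reflexive (eq p′)))) ⟩
    2 * p * (e * suc D) * suc u           ≡⟨ eq′ p e (suc D) (suc u) ⟩
    2 * suc u * e * p * suc D             ≤⟨ *-mono-≤ small (n≤1+n (suc D)) ⟩
    h * (2 + D)                           ≤⟨ hs≤k ⟩
    suc k                                 ∎
    where
    eq : ∀ q → 2 + 2 * q ≡ 2 * (1 + q)
    eq = solve-∀
    eq′ : ∀ p e d u → 2 * p * (e * d) * u ≡ 2 * u * e * p * d
    eq′ = solve-∀
  -- The 8 comes from 20p³ ≤ p⁸. Comparing both sides leaves precisely D ≥ 24 + 27c, the source of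
  -- that constant.
  exponents : 8 * suc u + (1 + 3 * c) * (2 + D) ≤ suc D * u
  exponents = begin
    8 * suc u + (1 + 3 * c) * (2 + D)                        ≡⟨ cong (λ z → 8 * z + (1 + 3 * c) * (2 + D)) u≡ ⟩
    8 * (3 * suc c) + (1 + 3 * c) * (2 + D)                  ≡⟨ eq c D ⟩
    (24 + 27 * c) + (2 + 3 * c + D + 3 * c * D)              ≤⟨ +-monoˡ-≤ (2 + 3 * c + D + 3 * c * D) D≥ ⟩
    D + (2 + 3 * c + D + 3 * c * D)                          ≡⟨ eq′ c D ⟩
    suc D * (2 + 3 * c)                                      ≡⟨ cong (suc D *_) (suc-injective (trans (eq₀ c) (sym u≡))) ⟩
    suc D * u                                                ∎
    where
    eq₀ : ∀ c → 1 + (2 + 3 * c) ≡ 3 * (1 + c)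
    eq₀ = solve-∀
    eq : ∀ c D → 8 * (3 * (1 + c)) + (1 + 3 * c) * (2 + D) ≡ (24 + 27 * c) + (2 + 3 * c + D + 3 * c * D)
    eq = solve-∀
    eq′ : ∀ c D → D + (2 + 3 * c + D + 3 * c * D) ≡ (1 + D) * (2 + 3 * c)
    eq′ = solve-∀

ramsey-from-primes : ∀ c H → (∀ h → H ≤ h → ∃₂ (GoodPrime (3 * suc c) h)) → ∀ s h k n →
  26 + 27 * c + H ≤ s → 26 + 27 * c + H ≤ h → h * s ≤ k → RamseyProperty s k n → suc h ^ (c * s) ≤ n ^ suc c
ramsey-from-primes c H primes (suc zero)    h       k       n (s≤s ()) _ _ _
ramsey-from-primes c H primes (suc (suc D)) h@(suc _) (suc k) n L≤s L≤h hs≤k ramsey =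
  ramsey-from-prime c (c + 2 * suc c) D h k n refl
    (s≤s⁻¹ (s≤s⁻¹ (≤-trans (m≤m+n (26 + 27 * c) H) L≤s))) hs≤k ramsey
    (primes h (≤-trans (m≤n+m H (26 + 27 * c)) L≤h))

abstract
  ramsey-lower-bound : ∀ c → ∃ λ L → ∀ s h k n → L ≤ s → L ≤ h → h * s ≤ k → RamseyProperty s k n →
    suc h ^ (c * s) ≤ n ^ suc c
  -- The inferred values are v₀, the threshold of `polynomial≤exponential`, then H = 2^v₀ and L = 26
  -- + 27c + H.
  ramsey-lower-bound c = _ , ramsey-from-primes c _ λ h → good-prime (3 * suc c) _ h
    λ v → polynomial≤exponential ((8 * (3 * suc c)) ^ (3 * suc c)) (2 * (3 * suc c)) v

-- Rational and real exponents

toℚᵘ-/ : ∀ k s → toℚᵘ (+ k / suc s) ℚᵘ.≃ mkℚᵘ (+ k) s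
toℚᵘ-/ k s = ℚ.toℚᵘ-fromℚᵘ (mkℚᵘ (+ k) s)

/-≤⁺ : ∀ k s y → k ≤ y * suc s → + k / suc s ℚ.≤ ℕ→ℚ y
/-≤⁺ k s y k≤ys = ℚ.toℚᵘ-cancel-≤
  (ℚᵘ.≤-respˡ-≃ (ℚᵘ.≃-sym (toℚᵘ-/ k s)) (ℚᵘ.≤-respʳ-≃ (ℚᵘ.≃-sym (toℚᵘ-/ y 0))
    (*≤* (subst₂ ℤ._≤_ (sym (ℤ.*-identityʳ (+ k))) (ℤ.pos-* y (suc s)) (ℤ.+≤+ k≤ys)))))

/-≤⁻ : ∀ k s y → + k / suc s ℚ.≤ ℕ→ℚ y → k ≤ y * suc s
/-≤⁻ k s y le with ℚᵘ.≤-respˡ-≃ (toℚᵘ-/ k s) (ℚᵘ.≤-respʳ-≃ (toℚᵘ-/ y 0) (ℚ.toℚᵘ-mono-≤ le))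
... | *≤* le′ = ℤ.drop‿+≤+ (subst₂ ℤ._≤_ (ℤ.*-identityʳ (+ k)) (sym (ℤ.pos-* y (suc s))) le′)

ℕ→ℚ-mono-≤ : ∀ m n → m ≤ n → ℕ→ℚ m ℚ.≤ ℕ→ℚ n
ℕ→ℚ-mono-≤ m n m≤n = /-≤⁺ m 0 n (subst (m ≤_) (sym (*-identityʳ n)) m≤n)

ℕ→ℚ-cancel-≤ : ∀ m n → ℕ→ℚ m ℚ.≤ ℕ→ℚ n → m ≤ n
ℕ→ℚ-cancel-≤ m n le = subst (m ≤_) (*-identityʳ n) (/-≤⁻ m 0 n le)

ℕ→ℚ-* : ∀ m n → ℕ→ℚ (m * n) ≡ ℕ→ℚ m ℚ.* ℕ→ℚ n
ℕ→ℚ-* m n = ℚ.toℚᵘ-injective (ℚᵘ.≃-trans (toℚᵘ-/ (m * n) 0)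
  (ℚᵘ.≃-trans (*≡* (cong (ℤ._* + 1) (ℤ.pos-* m n)))
  (ℚᵘ.≃-sym (ℚᵘ.≃-trans (ℚ.toℚᵘ-homo-* (ℕ→ℚ m) (ℕ→ℚ n)) (ℚᵘ.*-cong (toℚᵘ-/ m 0) (toℚᵘ-/ n 0))))))

ℕ→ℚ-^ : ∀ m n → ℕ→ℚ (m ^ n) ≡ ℕ→ℚ m Defs.^ n
ℕ→ℚ-^ m zero    = refl
ℕ→ℚ-^ m (suc n) = trans (ℕ→ℚ-* m (m ^ n)) (cong (ℕ→ℚ m ℚ.*_) (ℕ→ℚ-^ m n))

ℕ→ℚ-nonNegative : ∀ n → NonNegative (ℕ→ℚ n)
ℕ→ℚ-nonNegative n = ℚ.normalize-nonNeg n 1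

^-≤-ℕ→ℚ : ∀ x .{{_ : NonNegative x}} y j → x ℚ.≤ ℕ→ℚ y → x Defs.^ j ℚ.≤ ℕ→ℚ (y ^ j)
^-≤-ℕ→ℚ x y zero    x≤y = ℚ.≤-refl
^-≤-ℕ→ℚ x y (suc j) x≤y = begin
  x ℚ.* x Defs.^ j         ≤⟨ ℚ.*-monoˡ-≤-nonNeg x (^-≤-ℕ→ℚ x y j x≤y) ⟩
  x ℚ.* ℕ→ℚ (y ^ j)        ≤⟨ ℚ.*-monoʳ-≤-nonNeg (ℕ→ℚ (y ^ j)) {{ℕ→ℚ-nonNegative (y ^ j)}} x≤y ⟩
  ℕ→ℚ y ℚ.* ℕ→ℚ (y ^ j)    ≡⟨ ℕ→ℚ-* y (y ^ j) ⟨
  ℕ→ℚ (y * y ^ j)          ∎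
  where open ℚ.≤-Reasoning

1/-≤-1 : ∀ b .{{_ : Positive b}} → 1ℚ ℚ.≤ b → (1/ b) {{ℚ.pos⇒nonZero b}} ℚ.≤ 1ℚ
1/-≤-1 b 1≤b = ℚ.*-cancelˡ-≤-pos b (begin
  b ℚ.* 1/ b    ≡⟨ ℚ.*-inverseʳ b ⟩
  1ℚ            ≤⟨ 1≤b ⟩
  b             ≡⟨ ℚ.*-identityʳ b ⟨
  b ℚ.* 1ℚ      ∎)
  where
  open ℚ.≤-Reasoning
  instance
    _ = ℚ.pos⇒nonZero b

fromℕ-cancel-≤ : ∀ m n → fromℕ m ≤ℝ fromℕ n → m ≤ n
fromℕ-cancel-≤ m n le = ℕ→ℚ-cancel-≤ m n (ℚ.≮⇒≥ λ n<m → ℚ.<-irrefl refl (le n<m))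

fromℕ·-cancel-≤ : ∀ m k s → (fromℕ m · suc s) ≤ℝ fromℕ k → m * suc s ≤ k
fromℕ·-cancel-≤ m k s le = ≮⇒≥ λ k<ms → ℚ.<-irrefl refl (le {ℕ→ℚ k} (ℚ.toℚᵘ-cancel-<
  (ℚᵘ.<-respˡ-≃ (ℚᵘ.≃-sym (ℚᵘ.≃-trans (ℚ.toℚᵘ-homo-* (ℕ→ℚ k) (+ 1 / suc s)) (ℚᵘ.*-cong (toℚᵘ-/ k 0) (toℚᵘ-/ 1 s))))
    (ℚᵘ.<-respʳ-≃ (ℚᵘ.≃-sym (toℚᵘ-/ m 0))
      (*<* (subst₂ ℤ._<_ (sym (trans (ℤ.*-identityʳ (+ k ℤ.* + 1)) (ℤ.*-identityʳ (+ k))))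
        (trans (ℤ.pos-* m (suc s)) (cong (λ z → + m ℤ.* + suc z) (sym (+-identityʳ s)))) (ℤ.+<+ k<ms)))))))

lower<upper : ∀ x {p q} → Lower x p → Upper x q → p ℚ.< q
lower<upper x {p} {q} Lp Uq = ℚ.≰⇒> λ q≤p → disjoint x (below q≤p) Uq
  where
  below : q ℚ.≤ p → Lower x q
  below q≤p with q ℚ.<? p
  ... | yes q<p = lower-closed x q<p Lp
  ... | no q≮p = subst (Lower x) (ℚ.≤-antisym (ℚ.≮⇒≥ q≮p) q≤p) Lp

-- j/N < 1 − (a + 1)/(c + 1) with denominators cleared as in ℚᵘ.
clear-denominators : ∀ a c j N →
  + suc a ℤ.* + (1 * N) ℤ.< (+ 1 ℤ.* + N ℤ.+ (ℤ.- (+ j ℤ.* + 1)) ℤ.* + 1) ℤ.* + suc c →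
  j * suc c ≤ c * N
clear-denominators a c j N lt = +-cancelˡ-≤ N _ _ (begin
  N + j * suc c            ≤⟨ +-monoˡ-≤ (j * suc c) (m≤n*m N (suc a)) ⟩
  suc a * N + j * suc c    ≤⟨ <⇒≤ (ℤ.drop‿+<+ (subst₂ ℤ._<_ lhs rhs (ℤ.+-monoˡ-< (+ j ℤ.* + suc c) lt))) ⟩
  suc c * N                ∎)
  where
  open ≤-Reasoning
  lhs : + suc a ℤ.* + (1 * N) ℤ.+ + j ℤ.* + suc c ≡ + (suc a * N + j * suc c)
  lhs = trans (cong₂ ℤ._+_ (trans (sym (ℤ.pos-* (suc a) (1 * N))) (cong (λ z → + (suc a * z)) (*-identityˡ N))) (sym (ℤ.pos-* j (suc c))))
    (sym (ℤ.pos-+ (suc a * N) (j * suc c)))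
  ring : ∀ n j c → (+ 1 ℤ.* n ℤ.+ (ℤ.- (j ℤ.* + 1)) ℤ.* + 1) ℤ.* c ℤ.+ j ℤ.* c ≡ c ℤ.* n
  ring = ℤ-Solver.solve-∀
  rhs : (+ 1 ℤ.* + N ℤ.+ (ℤ.- (+ j ℤ.* + 1)) ℤ.* + 1) ℤ.* + suc c ℤ.+ + j ℤ.* + suc c ≡ + (suc c * N)
  rhs = trans (ring (+ N) (+ j) (+ suc c)) (sym (ℤ.pos-* (suc c) N))

exponent-bound : ∀ {a c j d} s .(cop₁ : Coprime (suc a) (suc c)) .(cop₂ : Coprime j (suc d)) →
  mkℚ (+ suc a) c cop₁ ℚ.< 1ℚ ℚ.- mkℚ (+ j) d cop₂ ℚ.* (+ 1 / suc s) →
  j * suc c ≤ c * (suc d * suc s)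
exponent-bound {a} {c} {j} {d} s cop₁ cop₂ q< with ℚᵘ.<-respʳ-≃ unnormalised (ℚ.toℚᵘ-mono-< q<)
  where
  t = mkℚ (+ j) d cop₂
  unnormalised : toℚᵘ (1ℚ ℚ.- t ℚ.* (+ 1 / suc s)) ℚᵘ.≃ mkℚᵘ (+ 1) 0 ℚᵘ.- mkℚᵘ (+ j) d ℚᵘ.* mkℚᵘ (+ 1) s
  unnormalised = ℚᵘ.≃-trans (ℚ.toℚᵘ-homo-+ 1ℚ (ℚ.- (t ℚ.* (+ 1 / suc s)))) (ℚᵘ.+-congʳ (mkℚᵘ (+ 1) 0)
    (ℚᵘ.≃-trans (ℚ.toℚᵘ-homo‿- (t ℚ.* (+ 1 / suc s))) (ℚᵘ.-‿cong
      (ℚᵘ.≃-trans (ℚ.toℚᵘ-homo-* t (+ 1 / suc s)) (ℚᵘ.*-cong {mkℚᵘ (+ j) d} ℚᵘ.≃-refl (toℚᵘ-/ 1 s))))))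
... | *<* lt = clear-denominators a c j (suc d * suc s) lt

root-exponents : ∀ y n c j d s .{{_ : NonZero y}} → j * suc c ≤ c * (d * s) →
  y ^ (c * s) ≤ n ^ suc c → y ^ j ≤ n ^ d
root-exponents y n c j d s j≤ le = ^-cancelʳ-≤ (suc c) (begin
  (y ^ j) ^ suc c      ≡⟨ ^-*-assoc y j (suc c) ⟩
  y ^ (j * suc c)      ≤⟨ ^-monoʳ-≤ y j≤ ⟩
  y ^ (c * (d * s))    ≡⟨ cong (y ^_) (eq c d s) ⟩
  y ^ (c * s * d)      ≡⟨ ^-*-assoc y (c * s) d ⟨
  (y ^ (c * s)) ^ d    ≤⟨ ^-monoˡ-≤ d le ⟩
  (n ^ suc c) ^ d      ≡⟨ trans (^-*-assoc n (suc c) d) (trans (cong (n ^_) (*-comm (suc c) d)) (sym (^-*-assoc n d (suc c)))) ⟩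
  (n ^ d) ^ suc c      ∎)
  where
  open ≤-Reasoning
  eq : ∀ c d s → c * (d * s) ≡ c * s * d
  eq = solve-∀

^ℚ-≤ : ∀ b .{{_ : Positive b}} {a c} y n s t .(cop : Coprime (suc a) (suc c)) .{{_ : NonZero y}} → 1ℚ ℚ.≤ b → b ℚ.≤ ℕ→ℚ y →
  y ^ (c * suc s) ≤ n ^ suc c → mkℚ (+ suc a) c cop ℚ.< 1ℚ ℚ.- t ℚ.* (+ 1 / suc s) → b ^ℚ t ≤ n
^ℚ-≤ b {c = c} y n s (mkℚ (+ j) d cop′) cop 1≤b b≤y le q< = begin
  b Defs.^ j            ≤⟨ ^-≤-ℕ→ℚ b {{ℚ.pos⇒nonNeg b}} y j b≤y ⟩
  ℕ→ℚ (y ^ j)           ≤⟨ ℕ→ℚ-mono-≤ (y ^ j) (n ^ suc d) (root-exponents y n c j (suc d) (suc s) (exponent-bound {d = d} s cop cop′ q<) le) ⟩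
  ℕ→ℚ (n ^ suc d)       ≡⟨ ℕ→ℚ-^ n (suc d) ⟩
  ℕ→ℚ n Defs.^ suc d    ∎
  where open ℚ.≤-Reasoning
-- For t < 0 the left side is at most 1. That n is positive follows from the hypothesis `le` itself,
-- through `root-exponents` with exponent 0.
^ℚ-≤ b {c = c} y n s (mkℚ -[1+ j ] d _) _ 1≤b b≤y le q< = begin
  (1/ b) Defs.^ suc j    ≤⟨ ^-≤-ℕ→ℚ (1/ b) 1 (suc j) (1/-≤-1 b 1≤b) ⟩
  ℕ→ℚ (1 ^ suc j)        ≤⟨ ℕ→ℚ-mono-≤ (1 ^ suc j) (n ^ suc d) (subst (_≤ n ^ suc d) (sym (^-zeroˡ (suc j))) (root-exponents y n c 0 (suc d) (suc s) z≤n le)) ⟩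
  ℕ→ℚ (n ^ suc d)        ≡⟨ ℕ→ℚ-^ n (suc d) ⟩
  ℕ→ℚ n Defs.^ suc d     ∎
  where
  open ℚ.≤-Reasoning
  instance
    b≢0 = ℚ.pos⇒nonZero b
    1/b≥0 : NonNegative (1/ b)
    1/b≥0 = ℚ.pos⇒nonNeg (1/ b) {{ℚ.1/pos⇒pos b}}

theorem1p3 : (δ : ℝ) → fromℚ 0ℚ <ℝ δ →
    ∃ λ (L : ℝ) → (s k : ℕ) .{{_ : NonZero s}} .{{_ : NonZero k}} →
    L ≤ℝ fromℕ s → (L · s) ≤ℝ fromℕ k →
    let instance k/s>0 = /-positive k s in
    (+ k / s) ^ℝ ((1ℚ ⊖ δ) · s) ≤ r s k
theorem1p3 δ (mkℚ (+ zero) c _ , ℚ.*<* lt , _) = contradiction lt (ℤ.<-irrefl refl)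
theorem1p3 δ (mkℚ -[1+ a ] c _ , ℚ.*<* () , _)
-- A rational (a + 1)/(c + 1) < δ gives 1 - δ < c/(c + 1), so the exponent c/(c + 1) suffices. The
-- added 2 makes k/s larger than 1.
theorem1p3 δ (mkℚ (+ suc a) c cop , _ , Lq) = fromℕ (2 + L) , bound
  where
  L = proj₁ (ramsey-lower-bound c)
  bound : (s k : ℕ) .{{_ : NonZero s}} .{{_ : NonZero k}} →
    fromℕ (2 + L) ≤ℝ fromℕ s → (fromℕ (2 + L) · s) ≤ℝ fromℕ k →
    let instance k/s>0 = /-positive k s in
    (+ k / s) ^ℝ ((1ℚ ⊖ δ) · s) ≤ r s k
  bound zero    k L≤s Ls≤k = contradiction (fromℕ-cancel-≤ (2 + L) 0 L≤s) λ ()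
  bound (suc s) k L≤s Ls≤k =
    -- Bounding the power of h + 1 for h = ⌊k/s⌋, rather than that of h, makes the rounding free of
    -- cost. Unfolded, `U` says δ < 1 - t/s.
    (λ 1≤b t U → ^ℚ-≤ (+ k / suc s) {{/-positive k (suc s)}} (suc h) (r (suc s) k) s t cop 1≤b
      (/-≤⁺ k s (suc h) (<⇒≤ (m<[1+m/n]*n k (suc s)))) main (lower<upper δ Lq U)) ,
    (λ b≤1 → contradiction (/-≤⁻ k s 1 b≤1) (<⇒≱ s<k))
    where
    h = k ℕ./ suc s
    2+L*s≤k : (2 + L) * suc s ≤ k
    2+L*s≤k = fromℕ·-cancel-≤ (2 + L) k s Ls≤k
    2+L≤h : 2 + L ≤ h
    2+L≤h = ≮⇒≥ λ h< → <⇒≱ (m<[1+m/n]*n k (suc s)) (≤-trans (*-monoˡ-≤ (suc s) h<) 2+L*s≤k)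
    s<k : 1 * suc s < k
    s<k = <-≤-trans (*-monoˡ-< (suc s) {1} {2 + L} (s≤s (s≤s z≤n))) 2+L*s≤k
    main : suc h ^ (c * suc s) ≤ r (suc s) k ^ suc c
    main = proj₂ (ramsey-lower-bound c) (suc s) h k (r (suc s) k)
      (≤-trans (m≤n+m L 2) (fromℕ-cancel-≤ (2 + L) (suc s) L≤s)) (≤-trans (m≤n+m L 2) 2+L≤h)
      (m/n*n≤m k (suc s)) (proj₁ (r-isLeast (suc s) k))
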